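{- (Completeness of $QLET_F$.) Let $\mathcal{S}=\langle\mathcal{C},\mathcal{P}\rangle$ be a signature and let $\Gamma\cup\{A\}\subseteq Sent(\mathcal{S})$. If $\Gamma\vDash A$, then $\Gamma\vdash A$ in $QLET_F$.
   Context: **Language.** A signature is a pair $\mathcal{S}=\langle\mathcal{C},\mathcal{P}\rangle$, where $\mathcal{C}$ is an infinite set of individual constants and $\mathcal{P}$ is a set of predicate letters, each of finite arity, containing a binary identity predicate $\approx$. The logical symbols are the unary connectives $\neg,\circ,\bullet$, the binary connectives $\land,\lor$, the quantifiers $\forall,\exists$, and variables $\mathcal{V}=\{v_i:i\in\mathbb{N}\}$. Terms are variables and constants (no function symbols). Formulas are defined as usual, except that void quantifiers are not allowed: $\forall xB$ and $\exists xB$ are formulas only if $x$ is free in $B$. $Form(\mathcal{S})$ and $Sent(\mathcal{S})$ are the sets of formulas and of sentences (closed formulas). $A(t/x)$ is the result of replacing every free occurrence of $x$ in $A$ by $t$. Two formulas are alphabetic variants if they differ only in (some of) their bound variables. **Natural deduction system $QLET_F$** (over sentences of $\mathcal{S}$; $c,c_1,c_2\in\mathcal{C}$; wherever $A(c/x)$ occurs, $A$ is a formula with no free variable other than $x$; square brackets mark discharged hypotheses): - $\land I$: from $A$, $B$ infer $A\land B$. $\land E$: from $A\land B$ infer $A$; from $A\land B$ infer $B$. - $\lor I$: from $A$ infer $A\lor B$; from $B$ infer $A\lor B$. $\lor E$: from $A\lor B$, a derivation of $C$ from $[A]$ and a derivation of $C$ from $[B]$, infer $C$. - $\neg\land I$: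 from $\neg A$ infer $\neg(A\land B)$; from $\neg B$ infer $\neg(A\land B)$. $\neg\land E$: from $\neg(A\land B)$, a derivation of $C$ from $[\neg A]$ and a derivation of $C$ from $[\neg B]$, infer $C$. - $\neg\lor I$: from $\neg A$, $\neg B$ infer $\neg(A\lor B)$. $\neg\lor E$: from $\neg(A\lor B)$ infer $\neg A$; from $\neg(A\lor B)$ infer $\neg B$. - $DN$: from $A$ infer $\neg\neg A$; from $\neg\neg A$ infer $A$. - $EXP^{\circ}$: from $\circ A$, $A$, $\neg A$ infer $B$. $PEM^{\circ}$: from $\circ A$ infer $A\lor\neg A$. - $Cons$: from $\circ A$, $\bullet A$ infer $B$. $Comp$: infer $\circ A\lor\bullet A$ from no premises. - $\forall I$: from $B\lor A(c/x)$ infer $B\lor\forall xA$, provided $c$ occurs neither in $A$ or $B$ nor in any hypothesis on which $B\lor A(c/x)$ depends. $\forall E$: from $\forall xA$ infer $A(c/x)$. - $\exists I$: from $A(c/x)$ infer $\exists xA$. $\exists E$: from $\exists xA$ and a derivation of $C$ from $[A(c/x)]$ infer $C$, provided $c$ occurs neither in $A$ or $C$ nor in any hypothesis on which $C$ depends, except $A(c/x)$. - $\neg\forall I$: from $\neg A(c/x)$ infer $\neg\forall xA$. $\neg\forall E$: from $\neg\forall xA$ and a derivation of $C$ from $[\neg A(c/x)]$ infer $C$, provided $c$ occurs neither in $A$ or $C$ nor in any hypothesis on which $C$ depends, except $\neg A(c/x)$. - $\neg\exists I$: from $\neg A(c/x)$ infer $\neg\exists xA$, provided $c$ occurs neither in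 $A$ nor in any hypothesis on which $\neg A(c/x)$ depends. $\neg\exists E$: from $\neg\exists xA$ infer $\neg A(c/x)$. - $\approx I$: infer $c\approx c$ from no premises. $\approx E$: from $c_1\approx c_2$ and $A(c_1/x)$ infer $A(c_2/x)$. - $AV$: from $A$ infer $A'$, for any alphabetic variant $A'$ of $A$. $\Gamma\vdash A$ (or $\Gamma\vdash_{\mathcal S}A$) means there is a (finite, tree-shaped) derivation of $A$ all of whose undischarged hypotheses belong to $\Gamma$. **Semantics.** An $\mathcal{S}$-structure is a pair $\mathfrak{A}=\langle\mathcal{D},\mathcal{I}\rangle$ with $\mathcal{D}\neq\emptyset$ such that $\mathcal{I}(c)=c^{\mathfrak{A}}\in\mathcal{D}$ for each $c\in\mathcal{C}$; each $n$-ary $P\in\mathcal{P}$ is assigned a pair $\langle P_+^{\mathfrak{A}},P_-^{\mathfrak{A}}\rangle$ with $P_+^{\mathfrak{A}}\cup P_-^{\mathfrak{A}}\subseteq\mathcal{D}^n$; and $\approx_+^{\mathfrak{A}}=\{\langle a,a\rangle:a\in\mathcal{D}\}$ (no constraint on $\approx_-^{\mathfrak A}$). The diagram signature $\mathcal{S}_{\mathfrak{A}}=\langle\mathcal{C}_{\mathfrak{A}},\mathcal{P}\rangle$ adds a new constant $\overline{a}$ for each $a\in\mathcal{D}$, i.e. $\mathcal{C}_{\mathfrak{A}}=\mathcal{C}\cup\{\overline{a}:a\in\mathcal{D}\}$; $\widehat{\mathfrak{A}}$ is the $\mathcal{S}_{\mathfrak{A}}$-structure that is just like $\mathfrak{A}$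 except that $\overline{a}^{\widehat{\mathfrak{A}}}=a$. A map $v:Sent(\mathcal{S}_{\mathfrak{A}})\to\{0,1\}$ is an $\mathfrak{A}$-valuation if: 1. $v(P(c_1,\dots,c_n))=1$ iff $\langle c_1^{\widehat{\mathfrak{A}}},\dots,c_n^{\widehat{\mathfrak{A}}}\rangle\in P_+^{\mathfrak{A}}$; 2. $v(\neg P(c_1,\dots,c_n))=1$ iff $\langle c_1^{\widehat{\mathfrak{A}}},\dots,c_n^{\widehat{\mathfrak{A}}}\rangle\in P_-^{\mathfrak{A}}$ (in 1 and 2, for all $c_1,\dots,c_n\in\mathcal{C}_{\mathfrak{A}}$); 3. $v(A\land B)=1$ iff $v(A)=1$ and $v(B)=1$; 4. $v(A\lor B)=1$ iff $v(A)=1$ or $v(B)=1$; 5. $v(\neg(A\land B))=1$ iff $v(\neg A)=1$ or $v(\neg B)=1$; 6. $v(\neg(A\lor B))=1$ iff $v(\neg A)=1$ and $v(\neg B)=1$; 7. $v(\neg\neg A)=1$ iff $v(A)=1$; 8. if $v(\circ A)=1$, then ($v(A)=1$ iff $v(\neg A)=0$); 9. $v(\circ A)=1$ iff $v(\bullet A)=0$; 10. $v(\forall xA)=1$ iff $v(A(\overline{a}/x))=1$ for every $a\in\mathcal{D}$; 11. $v(\exists xA)=1$ iff $v(A(\overline{a}/x))=1$ for some $a\in\mathcal{D}$; 12. $v(\neg\forall xA)=1$ iff $v(\neg A(\overline{a}/x))=1$ for some $a\in\mathcal{D}$; 13. $v(\neg\exists xA)=1$ iff $v(\neg A(\overline{a}/x))=1$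 for every $a\in\mathcal{D}$; 14. if $A'$ is an alphabetic variant of $A$, then $v(A')=v(A)$; 15. if $A\in Form(\mathcal{S}_{\mathfrak{A}})$ has no free variable other than $x$, $c_1,c_2\in\mathcal{C}_{\mathfrak{A}}$, $c_1^{\widehat{\mathfrak{A}}}=c_2^{\widehat{\mathfrak{A}}}$ and $v(A(c_1/x))=v(A(c_2/x))$, then $v(\#A(c_1/x))=v(\#A(c_2/x))$ for each $\#\in\{\neg,\circ,\bullet\}$. An $\mathcal{S}$-interpretation is a pair $\langle\mathfrak{A},v\rangle$ with $\mathfrak{A}$ an $\mathcal{S}$-structure and $v$ an $\mathfrak{A}$-valuation. $\mathfrak{A},v\vDash A$ means $v(A)=1$; $\mathfrak{A},v\vDash\Gamma$ means $v(B)=1$ for every $B\in\Gamma$. $\Gamma\vDash A$ means: for every $\mathcal{S}$-interpretation, $\mathfrak{A},v\vDash\Gamma$ implies $\mathfrak{A},v\vDash A$. -}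

module Defs where

open import Data.Bool.Base using (Bool; true; false)
open import Data.List.Base using (List; []; _∷_; mapMaybe)
open import Data.List.Membership.Propositional using () renaming (_∈_ to _∈ˡ_)
open import Data.List.Relation.Unary.Any using (here; there)
open import Data.List.Relation.Unary.Enumerates.Setoid using (IsEnumeration)
open import Data.Nat.Base using (ℕ)
open import Data.Nat.Properties using (_≟_)
open import Data.Product.Base using (_×_; _,_; ∃; Σ-syntax; proj₁; proj₂)
open import Data.Sum using (_⊎_; inj₁; inj₂; [_,_]; isInj₁)
import Data.Sum.Base as Sum
open import Data.Unit.Polymorphic.Base using (⊤; tt)
open import Data.Vec.Base as Vec using (Vec; []; _∷_)
open import Data.Vec.Membership.Propositional using () renaming (_∈_ to _∈ᵛ_)
open import Data.Vec.Relation.Binary.Pointwise.Inductive using (Pointwise)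
import Data.Vec.Relation.Unary.Any as Any
open import Data.Empty using (⊥-elim)
open import Data.Empty.Polymorphic using (⊥)
open import Function.Base using (id)
open import Function.Bundles using (_⇔_)
open import Level using (Level; 0ℓ; suc)
open import Relation.Binary.PropositionalEquality
  using (_≡_; _≢_; refl; sym; setoid)
open import Relation.Nullary using (¬_; yes; no)
open import Relation.Unary using (Pred; _∈_; _⊆_; _∪_; _∖_; ∅; ｛_｝)

private variable
  ℓ : Level

Infinite : Set ℓ → Set ℓ
Infinite A = ¬ ∃ (IsEnumeration (setoid A))

-- Letter n is the set of n-ary predicate letters.
record Signature (ℓ : Level) : Set (suc ℓ) where
  field
    Const    : Set ℓ
    infinite : Infinite Const
    Letter   : ℕ → Set ℓ
    identity : Letter 2

open Signature public

private variable
  𝒮 𝒮′ : Signature ℓ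

Var : Set
Var = ℕ

private variable
  X : Pred Var 0ℓ
  x x′ y y′ : Var

data Term (𝒮 : Signature ℓ) : Set ℓ where
  var : Var → Term 𝒮
  con : Const 𝒮 → Term 𝒮

data Unary : Set where
  neg circ bullet : Unary

data Binary : Set where
  and or : Binary

data Quantifier : Set where
  all ex : Quantifier

-- Void quantifiers are allowed here; IsFormula excludes them.
data Expr (𝒮 : Signature ℓ) : Set ℓ where
  atom : ∀ {n} → Letter 𝒮 n → Vec (Term 𝒮) n → Expr 𝒮
  un   : Unary → Expr 𝒮 → Expr 𝒮
  bin  : Binary → Expr 𝒮 → Expr 𝒮 → Expr 𝒮
  qu   : Quantifier → Var → Expr 𝒮 → Expr 𝒮

infix 4 _∈FV_ _∈C_

_∈FV_ : {𝒮 : Signature ℓ} → Var → Expr 𝒮 → Set ℓ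
x ∈FV atom P ts = var x ∈ᵛ ts
x ∈FV un # A    = x ∈FV A
x ∈FV bin ⊗ A B = x ∈FV A ⊎ x ∈FV B
x ∈FV qu Q y A  = x ≢ y × x ∈FV A

_∈C_ : {𝒮 : Signature ℓ} → Const 𝒮 → Expr 𝒮 → Set ℓ
c ∈C atom P ts = con c ∈ᵛ ts
c ∈C un # A    = c ∈C A
c ∈C bin ⊗ A B = c ∈C A ⊎ c ∈C B
c ∈C qu Q y A  = c ∈C A

IsFormula : {𝒮 : Signature ℓ} → Expr 𝒮 → Set ℓ
IsFormula (atom P ts)  = ⊤
IsFormula (un # A)     = IsFormula A
IsFormula (bin ⊗ A B)  = IsFormula A × IsFormula B
IsFormula (qu Q x A)   = x ∈FV A × IsFormula A

substTerm : Term 𝒮 → Const 𝒮 → Var → Term 𝒮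
substTerm (var y) c x with x ≟ y
... | yes _ = con c
... | no _  = var y
substTerm (con d) c x = con d

infix 9 _[_/_]

_[_/_] : Expr 𝒮 → Const 𝒮 → Var → Expr 𝒮
atom P ts [ c / x ] = atom P (Vec.map (λ t → substTerm t c x) ts)
un # A    [ c / x ] = un # (A [ c / x ])
bin ⊗ A B [ c / x ] = bin ⊗ (A [ c / x ]) (B [ c / x ])
qu Q y A  [ c / x ] with x ≟ y
... | yes _ = qu Q y A
... | no _  = qu Q y (A [ c / x ])

mapTerm : (Const 𝒮 → Const 𝒮′) → Term 𝒮 → Term 𝒮′
mapTerm f (var x) = var x
mapTerm f (con c) = con (f c)

mapExpr : (Const 𝒮 → Const 𝒮′) → (∀ {n} → Letter 𝒮 n → Letter 𝒮′ n) →
          Expr 𝒮 → Expr 𝒮′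
mapExpr f g (atom P ts)  = atom (g P) (Vec.map (mapTerm f) ts)
mapExpr f g (un # A)     = un # (mapExpr f g A)
mapExpr f g (bin ⊗ A B)  = bin ⊗ (mapExpr f g A) (mapExpr f g B)
mapExpr f g (qu Q x A)   = qu Q x (mapExpr f g A)

private variable
  ρ : List (Var × Var)

-- The list holds the pairs of variables bound by corresponding
-- quantifiers, innermost first: corresponding occurrences must be bound
-- by corresponding quantifiers, or be free occurrences of one variable.
data VarMatch : List (Var × Var) → Var → Var → Set where
  free  : VarMatch [] x x
  bound : VarMatch ((x , y) ∷ ρ) x y
  skip  : x ≢ x′ → y ≢ y′ → VarMatch ρ x y → VarMatch ((x′ , y′) ∷ ρ) x y

data TermMatch {𝒮 : Signature ℓ} (ρ : List (Var × Var)) :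
               Term 𝒮 → Term 𝒮 → Set ℓ where
  var : VarMatch ρ x y → TermMatch ρ (var x) (var y)
  con : ∀ {c} → TermMatch ρ (con c) (con c)

data ExprMatch {𝒮 : Signature ℓ} (ρ : List (Var × Var)) :
               Expr 𝒮 → Expr 𝒮 → Set ℓ where
  atom : ∀ {n} {P : Letter 𝒮 n} {ts us} →
         Pointwise (TermMatch ρ) ts us →
         ExprMatch ρ (atom P ts) (atom P us)
  un   : ∀ {# A A′} → ExprMatch ρ A A′ → ExprMatch ρ (un # A) (un # A′)
  bin  : ∀ {⊗ A A′ B B′} → ExprMatch ρ A A′ → ExprMatch ρ B B′ →
         ExprMatch ρ (bin ⊗ A B) (bin ⊗ A′ B′)
  qu   : ∀ {Q A A′} → ExprMatch ((x , x′) ∷ ρ) A A′ →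
         ExprMatch ρ (qu Q x A) (qu Q x′ A′)

private
  FV-substTerms⁻ : ∀ {n} (ts : Vec (Term 𝒮) n) {c} →
    var y ∈ᵛ Vec.map (λ t → substTerm t c x) ts → var y ∈ᵛ ts × x ≢ y
  FV-substTerms⁻ {x = x} (var z ∷ ts) (Any.here p) with x ≟ z | p
  ... | no x≢z | refl = Any.here refl , x≢z
  FV-substTerms⁻ (t ∷ ts) (Any.there p) with FV-substTerms⁻ ts p
  ... | q , x≢y = Any.there q , x≢y

  FV-substTerms⁺ : ∀ {n} (ts : Vec (Term 𝒮) n) {c} → x ≢ y →
    var y ∈ᵛ ts → var y ∈ᵛ Vec.map (λ t → substTerm t c x) ts
  FV-substTerms⁺ {x = x} {y = y} (_ ∷ ts) x≢y (Any.here refl) with x ≟ y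
  ... | yes x≡y = ⊥-elim (x≢y x≡y)
  ... | no _    = Any.here refl
  FV-substTerms⁺ (t ∷ ts) x≢y (Any.there p) =
    Any.there (FV-substTerms⁺ ts x≢y p)

  FV-mapTerms⁻ : (f : Const 𝒮 → Const 𝒮′) → ∀ {n} (ts : Vec (Term 𝒮) n) →
    var x ∈ᵛ Vec.map (mapTerm {𝒮′ = 𝒮′} f) ts → var x ∈ᵛ ts
  FV-mapTerms⁻ f (var z ∷ ts) (Any.here refl) = Any.here refl
  FV-mapTerms⁻ f (t ∷ ts)     (Any.there p)   = Any.there (FV-mapTerms⁻ f ts p)

  FV-mapTerms⁺ : (f : Const 𝒮 → Const 𝒮′) → ∀ {n} (ts : Vec (Term 𝒮) n) →
    var x ∈ᵛ ts → var x ∈ᵛ Vec.map (mapTerm {𝒮′ = 𝒮′} f) ts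
  FV-mapTerms⁺ f (_ ∷ ts) (Any.here refl) = Any.here refl
  FV-mapTerms⁺ f (t ∷ ts) (Any.there p)   = Any.there (FV-mapTerms⁺ f ts p)

FV-subst⁻ : (A : Expr 𝒮) → ∀ {c} →
            y ∈FV A [ c / x ] → y ∈FV A × x ≢ y
FV-subst⁻ (atom P ts)         p        = FV-substTerms⁻ ts p
FV-subst⁻ (un # A)            p        = FV-subst⁻ A p
FV-subst⁻ (bin ⊗ A B)         (inj₁ p) with FV-subst⁻ A p
... | q , x≢y = inj₁ q , x≢y
FV-subst⁻ (bin ⊗ A B)         (inj₂ p) with FV-subst⁻ B p
... | q , x≢y = inj₂ q , x≢y
FV-subst⁻ {x = x} (qu Q z A)  p        with x ≟ z | p
... | yes refl | y≢z , q = (y≢z , q) , (λ x≡y → y≢z (sym x≡y))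
... | no _     | y≢z , q with FV-subst⁻ A q
...   | r , x≢y = (y≢z , r) , x≢y

FV-subst⁺ : (A : Expr 𝒮) → ∀ {c} → x ≢ y →
            y ∈FV A → y ∈FV A [ c / x ]
FV-subst⁺ (atom P ts)         x≢y p        = FV-substTerms⁺ ts x≢y p
FV-subst⁺ (un # A)            x≢y p        = FV-subst⁺ A x≢y p
FV-subst⁺ (bin ⊗ A B)         x≢y (inj₁ p) = inj₁ (FV-subst⁺ A x≢y p)
FV-subst⁺ (bin ⊗ A B)         x≢y (inj₂ p) = inj₂ (FV-subst⁺ B x≢y p)
FV-subst⁺ {x = x} (qu Q z A)  x≢y (y≢z , p) with x ≟ z
... | yes _ = y≢z , p
... | no _  = y≢z , FV-subst⁺ A x≢y p

subst-closed : (A : Expr 𝒮) → ∀ {c} → (∀ {y} → y ∈FV A → x ≡ y) →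
               y ∈FV A [ c / x ] → ∅ y
subst-closed A scoped y∈ with FV-subst⁻ A y∈
... | y∈A , x≢y = x≢y (scoped y∈A)

IsFormula-subst : (A : Expr 𝒮) → ∀ {c} →
                  IsFormula A → IsFormula (A [ c / x ])
IsFormula-subst (atom P ts)        _       = tt
IsFormula-subst (un # A)           p       = IsFormula-subst A p
IsFormula-subst (bin ⊗ A B)        (p , q) = IsFormula-subst A p , IsFormula-subst B q
IsFormula-subst {x = x} (qu Q z A) (p , q) with x ≟ z
... | yes _  = p , q
... | no x≢z = FV-subst⁺ A x≢z p , IsFormula-subst A q

module _ (f : Const 𝒮 → Const 𝒮′) (g : ∀ {n} → Letter 𝒮 n → Letter 𝒮′ n) where

  FV-map⁻ : (A : Expr 𝒮) → x ∈FV mapExpr {𝒮′ = 𝒮′} f g A → x ∈FV A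
  FV-map⁻ (atom P ts) p         = FV-mapTerms⁻ {𝒮′ = 𝒮′} f ts p
  FV-map⁻ (un # A)    p         = FV-map⁻ A p
  FV-map⁻ (bin ⊗ A B)           = Sum.map (FV-map⁻ A) (FV-map⁻ B)
  FV-map⁻ (qu Q y A)  (x≢y , p) = x≢y , FV-map⁻ A p

  FV-map⁺ : (A : Expr 𝒮) → x ∈FV A → x ∈FV mapExpr {𝒮′ = 𝒮′} f g A
  FV-map⁺ (atom P ts) p         = FV-mapTerms⁺ {𝒮′ = 𝒮′} f ts p
  FV-map⁺ (un # A)    p         = FV-map⁺ A p
  FV-map⁺ (bin ⊗ A B)           = Sum.map (FV-map⁺ A) (FV-map⁺ B)
  FV-map⁺ (qu Q y A)  (x≢y , p) = x≢y , FV-map⁺ A p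

  IsFormula-map : (A : Expr 𝒮) → IsFormula A →
                  IsFormula (mapExpr {𝒮′ = 𝒮′} f g A)
  IsFormula-map (atom P ts) _       = tt
  IsFormula-map (un # A)    p       = IsFormula-map A p
  IsFormula-map (bin ⊗ A B) (p , q) = IsFormula-map A p , IsFormula-map B q
  IsFormula-map (qu Q y A)  (p , q) = FV-map⁺ A p , IsFormula-map A q

-- Formulas all of whose free variables belong to X.  The proofs are
-- irrelevant, so a formula is determined by its underlying expression.
record Form (𝒮 : Signature ℓ) (X : Pred Var 0ℓ) : Set ℓ where
  constructor form
  field
    expr       : Expr 𝒮
    .isFormula : IsFormula expr
    .scoped    : ∀ {y} → y ∈FV expr → X y

open Form public using (expr)

Sentence : Signature ℓ → Set ℓ
Sentence 𝒮 = Form 𝒮 ∅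

unary : Unary → Form 𝒮 X → Form 𝒮 X
unary # (form A p s) = form (un # A) p s

binary : Binary → Form 𝒮 X → Form 𝒮 X → Form 𝒮 X
binary ⊗ (form A p s) (form B q r) = form (bin ⊗ A B) (p , q) [ s , r ]

quantify : Quantifier → (A : Form 𝒮 ｛ x ｝) → .(x ∈FV expr A) → Sentence 𝒮
quantify {x = x} Q (form A p s) x∈A =
  form (qu Q x A) (x∈A , p) (λ (y≢x , y∈A) → y≢x (sym (s y∈A)))

infix  10 ¬̇_ ∘̇_ ●̇_
infixr 7 _∧̇_
infixr 6 _∨̇_
infix  8 _≈̇_
infix  11 _⟨_⟩

¬̇_ ∘̇_ ●̇_ : Form 𝒮 X → Form 𝒮 X
¬̇_ = unary neg
∘̇_ = unary circ
●̇_ = unary bullet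

_∧̇_ _∨̇_ : Form 𝒮 X → Form 𝒮 X → Form 𝒮 X
_∧̇_ = binary and
_∨̇_ = binary or

∀̇ ∃̇ : (A : Form 𝒮 ｛ x ｝) → .(x ∈FV expr A) → Sentence 𝒮
∀̇ = quantify all
∃̇ = quantify ex

-- A ⟨ c ⟩ is A(c/x), where A has no free variable other than x.
_⟨_⟩ : Form 𝒮 ｛ x ｝ → Const 𝒮 → Sentence 𝒮
_⟨_⟩ {x = x} (form A p s) c =
  form (A [ c / x ]) (IsFormula-subst A p) (subst-closed A s)

private
  noVars : ∀ {n} (cs : Vec (Const 𝒮) n) → ¬ (var {𝒮 = 𝒮} x ∈ᵛ Vec.map con cs)
  noVars (c ∷ cs) (Any.there p) = noVars cs p

atomic : ∀ {n} → Letter 𝒮 n → Vec (Const 𝒮) n → Sentence 𝒮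
atomic P cs = form (atom P (Vec.map con cs)) tt (noVars cs)

_≈̇_ : Const 𝒮 → Const 𝒮 → Sentence 𝒮
_≈̇_ {𝒮 = 𝒮} c d = atomic (identity 𝒮) (c ∷ d ∷ [])

AlphabeticVariants : {𝒮 : Signature ℓ} → Form 𝒮 X → Form 𝒮 X → Set ℓ
AlphabeticVariants A A′ = ExprMatch [] (expr A) (expr A′)

infix 4 _occursIn_

_occursIn_ : {𝒮 : Signature ℓ} → Const 𝒮 → Form 𝒮 X → Set ℓ
c occursIn A = c ∈C expr A

-- Hyps d is the set of undischarged hypotheses of d.  It is defined
-- together with derivations because the provisos of the quantifier rules
-- refer to it.  A rule that discharges a hypothesis discharges all its
-- occurrences in the relevant subderivation.
data Derivation {ℓ} (𝒮 : Signature ℓ) : Sentence 𝒮 → Set ℓ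

Hyps : {𝒮 : Signature ℓ} {A : Sentence 𝒮} → Derivation 𝒮 A → Pred (Sentence 𝒮) ℓ

data Derivation {ℓ} 𝒮 where
  hyp  : ∀ A → Derivation 𝒮 A

  ∧I   : ∀ {A B} → Derivation 𝒮 A → Derivation 𝒮 B → Derivation 𝒮 (A ∧̇ B)
  ∧E₁  : ∀ A B → Derivation 𝒮 (A ∧̇ B) → Derivation 𝒮 A
  ∧E₂  : ∀ A B → Derivation 𝒮 (A ∧̇ B) → Derivation 𝒮 B

  ∨I₁  : ∀ A B → Derivation 𝒮 A → Derivation 𝒮 (A ∨̇ B)
  ∨I₂  : ∀ A B → Derivation 𝒮 B → Derivation 𝒮 (A ∨̇ B)
  ∨E   : ∀ A B {C} → Derivation 𝒮 (A ∨̇ B) →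
         Derivation 𝒮 C → Derivation 𝒮 C → Derivation 𝒮 C

  ¬∧I₁ : ∀ A B → Derivation 𝒮 (¬̇ A) → Derivation 𝒮 (¬̇ (A ∧̇ B))
  ¬∧I₂ : ∀ A B → Derivation 𝒮 (¬̇ B) → Derivation 𝒮 (¬̇ (A ∧̇ B))
  ¬∧E  : ∀ A B {C} → Derivation 𝒮 (¬̇ (A ∧̇ B)) →
         Derivation 𝒮 C → Derivation 𝒮 C → Derivation 𝒮 C

  ¬∨I  : ∀ A B → Derivation 𝒮 (¬̇ A) → Derivation 𝒮 (¬̇ B) →
         Derivation 𝒮 (¬̇ (A ∨̇ B))
  ¬∨E₁ : ∀ A B → Derivation 𝒮 (¬̇ (A ∨̇ B)) → Derivation 𝒮 (¬̇ A)
  ¬∨E₂ : ∀ A B → Derivation 𝒮 (¬̇ (A ∨̇ B)) → Derivation 𝒮 (¬̇ B)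

  DNI  : ∀ {A} → Derivation 𝒮 A → Derivation 𝒮 (¬̇ ¬̇ A)
  DNE  : ∀ {A} → Derivation 𝒮 (¬̇ ¬̇ A) → Derivation 𝒮 A

  EXP° : ∀ {A} B → Derivation 𝒮 (∘̇ A) → Derivation 𝒮 A →
         Derivation 𝒮 (¬̇ A) → Derivation 𝒮 B
  PEM° : ∀ A → Derivation 𝒮 (∘̇ A) → Derivation 𝒮 (A ∨̇ ¬̇ A)

  Cons : ∀ A B → Derivation 𝒮 (∘̇ A) → Derivation 𝒮 (●̇ A) → Derivation 𝒮 B
  Comp : ∀ A → Derivation 𝒮 (∘̇ A ∨̇ ●̇ A)

  ∀I   : ∀ {x} B (A : Form 𝒮 ｛ x ｝) .(x∈A : x ∈FV expr A) c →
         (d : Derivation 𝒮 (B ∨̇ A ⟨ c ⟩)) →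
         ¬ (c occursIn A) → ¬ (c occursIn B) →
         (∀ {H} → H ∈ Hyps d → ¬ (c occursIn H)) →
         Derivation 𝒮 (B ∨̇ ∀̇ A x∈A)
  ∀E   : ∀ {x} (A : Form 𝒮 ｛ x ｝) .(x∈A : x ∈FV expr A) c →
         Derivation 𝒮 (∀̇ A x∈A) → Derivation 𝒮 (A ⟨ c ⟩)

  ∃I   : ∀ {x} (A : Form 𝒮 ｛ x ｝) .(x∈A : x ∈FV expr A) c →
         Derivation 𝒮 (A ⟨ c ⟩) → Derivation 𝒮 (∃̇ A x∈A)
  ∃E   : ∀ {x C} (A : Form 𝒮 ｛ x ｝) .(x∈A : x ∈FV expr A) c →
         Derivation 𝒮 (∃̇ A x∈A) → (d : Derivation 𝒮 C) →
         ¬ (c occursIn A) → ¬ (c occursIn C) →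
         (∀ {H} → H ∈ Hyps d ∖ ｛ A ⟨ c ⟩ ｝ → ¬ (c occursIn H)) →
         Derivation 𝒮 C

  ¬∀I  : ∀ {x} (A : Form 𝒮 ｛ x ｝) .(x∈A : x ∈FV expr A) c →
         Derivation 𝒮 (¬̇ (A ⟨ c ⟩)) → Derivation 𝒮 (¬̇ (∀̇ A x∈A))
  ¬∀E  : ∀ {x C} (A : Form 𝒮 ｛ x ｝) .(x∈A : x ∈FV expr A) c →
         Derivation 𝒮 (¬̇ (∀̇ A x∈A)) → (d : Derivation 𝒮 C) →
         ¬ (c occursIn A) → ¬ (c occursIn C) →
         (∀ {H} → H ∈ Hyps d ∖ ｛ ¬̇ (A ⟨ c ⟩) ｝ → ¬ (c occursIn H)) →
         Derivation 𝒮 C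

  ¬∃I  : ∀ {x} (A : Form 𝒮 ｛ x ｝) .(x∈A : x ∈FV expr A) c →
         (d : Derivation 𝒮 (¬̇ (A ⟨ c ⟩))) →
         ¬ (c occursIn A) →
         (∀ {H} → H ∈ Hyps d → ¬ (c occursIn H)) →
         Derivation 𝒮 (¬̇ (∃̇ A x∈A))
  ¬∃E  : ∀ {x} (A : Form 𝒮 ｛ x ｝) .(x∈A : x ∈FV expr A) c →
         Derivation 𝒮 (¬̇ (∃̇ A x∈A)) → Derivation 𝒮 (¬̇ (A ⟨ c ⟩))

  ≈I   : ∀ c → Derivation 𝒮 (c ≈̇ c)
  ≈E   : ∀ {x} (A : Form 𝒮 ｛ x ｝) c₁ c₂ →
         Derivation 𝒮 (c₁ ≈̇ c₂) → Derivation 𝒮 (A ⟨ c₁ ⟩) → Derivation 𝒮 (A ⟨ c₂ ⟩)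

  AV   : ∀ {A A′} → AlphabeticVariants A A′ → Derivation 𝒮 A → Derivation 𝒮 A′

Hyps (hyp A)           = ｛ A ｝
Hyps (∧I d e)          = Hyps d ∪ Hyps e
Hyps (∧E₁ A B d)       = Hyps d
Hyps (∧E₂ A B d)       = Hyps d
Hyps (∨I₁ A B d)       = Hyps d
Hyps (∨I₂ A B d)       = Hyps d
Hyps (∨E A B d d₁ d₂)  = Hyps d ∪ (Hyps d₁ ∖ ｛ A ｝) ∪ (Hyps d₂ ∖ ｛ B ｝)
Hyps (¬∧I₁ A B d)      = Hyps d
Hyps (¬∧I₂ A B d)      = Hyps d
Hyps (¬∧E A B d d₁ d₂) = Hyps d ∪ (Hyps d₁ ∖ ｛ ¬̇ A ｝) ∪ (Hyps d₂ ∖ ｛ ¬̇ B ｝)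
Hyps (¬∨I A B d e)     = Hyps d ∪ Hyps e
Hyps (¬∨E₁ A B d)      = Hyps d
Hyps (¬∨E₂ A B d)      = Hyps d
Hyps (DNI d)           = Hyps d
Hyps (DNE d)           = Hyps d
Hyps (EXP° B d e f)    = Hyps d ∪ Hyps e ∪ Hyps f
Hyps (PEM° A d)        = Hyps d
Hyps (Cons A B d e)    = Hyps d ∪ Hyps e
Hyps (Comp A)          = λ _ → ⊥
Hyps (∀I B A x∈A c d _ _ _)   = Hyps d
Hyps (∀E A x∈A c d)           = Hyps d
Hyps (∃I A x∈A c d)           = Hyps d
Hyps (∃E A x∈A c d e _ _ _)   = Hyps d ∪ (Hyps e ∖ ｛ A ⟨ c ⟩ ｝)
Hyps (¬∀I A x∈A c d)          = Hyps d
Hyps (¬∀E A x∈A c d e _ _ _)  = Hyps d ∪ (Hyps e ∖ ｛ ¬̇ (A ⟨ c ⟩) ｝)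
Hyps (¬∃I A x∈A c d _ _)      = Hyps d
Hyps (¬∃E A x∈A c d)          = Hyps d
Hyps (≈I c)            = λ _ → ⊥
Hyps (≈E A c₁ c₂ d e)  = Hyps d ∪ Hyps e
Hyps (AV A∼A′ d)       = Hyps d

infix 3 _⊢_ _⊨_

_⊢_ : {𝒮 : Signature ℓ} → Pred (Sentence 𝒮) ℓ → Sentence 𝒮 → Set ℓ
_⊢_ {𝒮 = 𝒮} Γ A = Σ[ d ∈ Derivation 𝒮 A ] Hyps d ⊆ Γ

record Structure (𝒮 : Signature ℓ) : Set (suc ℓ) where
  field
    Domain    : Set ℓ
    inhabited : Domain
    ⟦_⟧ᶜ      : Const 𝒮 → Domain
    ⟦_⟧₊ ⟦_⟧₋ : ∀ {n} → Letter 𝒮 n → Pred (Vec Domain n) ℓ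
    identity₊ : ∀ a b → (a ∷ b ∷ []) ∈ ⟦ identity 𝒮 ⟧₊ ⇔ a ≡ b

infinite-⊎ : {C D : Set ℓ} → Infinite C → Infinite (C ⊎ D)
infinite-⊎ {C = C} {D} inf (zs , enum) =
  inf (mapMaybe isInj₁ zs , λ c → lefts zs (enum (inj₁ c)))
  where
  lefts : ∀ zs {c : C} → inj₁ c ∈ˡ zs → c ∈ˡ mapMaybe (isInj₁ {B = D}) zs
  lefts (inj₁ _ ∷ zs) (here refl) = here refl
  lefts (inj₁ _ ∷ zs) (there p)   = there (lefts zs p)
  lefts (inj₂ _ ∷ zs) (there p)   = lefts zs p

extend : Signature ℓ → Set ℓ → Signature ℓ
extend 𝒮 D = record
  { Const    = Const 𝒮 ⊎ D
  ; infinite = infinite-⊎ (infinite 𝒮)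
  ; Letter   = Letter 𝒮
  ; identity = identity 𝒮
  }

embed : ∀ {D} → Form 𝒮 X → Form (extend 𝒮 D) X
embed {𝒮 = 𝒮} {D = D} (form A p s) =
  form (mapExpr inj₁ id A)
       (IsFormula-map inj₁ id A p)
       (λ y∈ → s (FV-map⁻ {𝒮′ = extend 𝒮 D} inj₁ id A y∈))

module _ {𝒮 : Signature ℓ} (𝔄 : Structure 𝒮) where
  open Structure 𝔄

  diagram : Signature ℓ
  diagram = extend 𝒮 Domain

  -- The constant naming a in the diagram signature.
  name : Domain → Const diagram
  name = inj₂

  expansion : Structure diagram
  expansion = record
    { Domain    = Domain
    ; inhabited = inhabited
    ; ⟦_⟧ᶜ      = [ ⟦_⟧ᶜ , id ]
    ; ⟦_⟧₊      = ⟦_⟧₊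
    ; ⟦_⟧₋      = ⟦_⟧₋
    ; identity₊ = identity₊
    }

  private module 𝔄̂ = Structure expansion

  module _ (v : Sentence diagram → Bool) where
    private
      True False : Sentence diagram → Set
      True  A = v A ≡ true
      False A = v A ≡ false

    record IsValuation : Set ℓ where
      field
        v-atom  : ∀ {n} (P : Letter 𝒮 n) cs →
                  True (atomic P cs) ⇔ Vec.map 𝔄̂.⟦_⟧ᶜ cs ∈ ⟦ P ⟧₊
        v-¬atom : ∀ {n} (P : Letter 𝒮 n) cs →
                  True (¬̇ atomic P cs) ⇔ Vec.map 𝔄̂.⟦_⟧ᶜ cs ∈ ⟦ P ⟧₋
        v-∧     : ∀ A B → True (A ∧̇ B) ⇔ (True A × True B)
        v-∨     : ∀ A B → True (A ∨̇ B) ⇔ (True A ⊎ True B)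
        v-¬∧    : ∀ A B → True (¬̇ (A ∧̇ B)) ⇔ (True (¬̇ A) ⊎ True (¬̇ B))
        v-¬∨    : ∀ A B → True (¬̇ (A ∨̇ B)) ⇔ (True (¬̇ A) × True (¬̇ B))
        v-¬¬    : ∀ A → True (¬̇ ¬̇ A) ⇔ True A
        v-∘     : ∀ A → True (∘̇ A) → True A ⇔ False (¬̇ A)
        v-●     : ∀ A → True (∘̇ A) ⇔ False (●̇ A)
        v-∀     : ∀ {x} (A : Form diagram ｛ x ｝) .(x∈A : x ∈FV expr A) →
                  True (∀̇ A x∈A) ⇔ (∀ a → True (A ⟨ name a ⟩))
        v-∃     : ∀ {x} (A : Form diagram ｛ x ｝) .(x∈A : x ∈FV expr A) →
                  True (∃̇ A x∈A) ⇔ (∃ λ a → True (A ⟨ name a ⟩))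
        v-¬∀    : ∀ {x} (A : Form diagram ｛ x ｝) .(x∈A : x ∈FV expr A) →
                  True (¬̇ (∀̇ A x∈A)) ⇔ (∃ λ a → True (¬̇ (A ⟨ name a ⟩)))
        v-¬∃    : ∀ {x} (A : Form diagram ｛ x ｝) .(x∈A : x ∈FV expr A) →
                  True (¬̇ (∃̇ A x∈A)) ⇔ (∀ a → True (¬̇ (A ⟨ name a ⟩)))
        v-AV    : ∀ A A′ → AlphabeticVariants A A′ → v A′ ≡ v A
        v-≈     : ∀ {x} (A : Form diagram ｛ x ｝) c₁ c₂ →
                  𝔄̂.⟦ c₁ ⟧ᶜ ≡ 𝔄̂.⟦ c₂ ⟧ᶜ →
                  v (A ⟨ c₁ ⟩) ≡ v (A ⟨ c₂ ⟩) →
                  ∀ # → v (unary # (A ⟨ c₁ ⟩)) ≡ v (unary # (A ⟨ c₂ ⟩))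

record Interpretation (𝒮 : Signature ℓ) : Set (suc ℓ) where
  field
    structure   : Structure 𝒮
    valuation   : Sentence (diagram structure) → Bool
    isValuation : IsValuation structure valuation

  Satisfies : Sentence 𝒮 → Set
  Satisfies A = valuation (embed A) ≡ true

open Interpretation public using (Satisfies)

_⊨_ : {𝒮 : Signature ℓ} → Pred (Sentence 𝒮) ℓ → Sentence 𝒮 → Set (suc ℓ)
_⊨_ {𝒮 = 𝒮} Γ A = (ℐ : Interpretation 𝒮) → Γ ⊆ Satisfies ℐ → Satisfies ℐ A

{-# OPTIONS --safe #-}
module Submission where

-- Suppose Γ ⊬ A.  New constants are added, one for each formula with one
-- free variable and each kind of quantifier rule, together with the
-- corresponding Henkin axioms, e.g. ∃x B → B(c) and B(c) → ∀x B.  The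
-- language has no implication, so an axiom P → Q is used in the form
-- "from Γ, Q ⊢ R and Γ ⊢ R ∨ P infer Γ ⊢ R".  The axioms are conservative:
-- finitely many of them can be ordered so that the constant of each does
-- not occur in the earlier ones, and then be eliminated starting from the
-- last; the side formula of ∀I is what makes this possible for ∀.  A
-- theory that is maximal among those not yielding A is therefore closed
-- under deduction, prime, and has witnesses for all quantifiers.  It
-- defines an interpretation on the quotient of the constants by ≈ in which
-- Γ holds and A fails.  Excluded middle for all of Set ℓ provides choice.

open import Defs
open import Axiom.ExcludedMiddle using (ExcludedMiddle)
open import Axiom.Extensionality.Propositional using (Extensionality; lower-extensionality)
open import Data.Bool.Base using (Bool; true; false; _∨_)
open import Data.Bool.Properties using (¬-not)
open import Data.Empty using (⊥-elim)
open import Data.List.Base as List using (List; []; _∷_; _++_; concatMap; filter)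
open import Data.List.Membership.Propositional using () renaming (_∈_ to _∈ˡ_)
open import Data.List.Membership.Propositional.Properties
  using (∈-++⁺ˡ; ∈-++⁺ʳ; ∈-concatMap⁺; ∈-filter⁺; ∈-filter⁻; ∈-map⁺)
open import Data.List.Relation.Unary.All as All using ([]; _∷_)
open import Data.List.Relation.Unary.AllPairs using (AllPairs; []; _∷_)
open import Data.List.Relation.Unary.Any as AnyL using (here; there)
open import Data.Nat.Base using (ℕ; _≤_; _<_; suc; _+_)
open import Data.Nat.Properties
  using (_≟_; _≤?_; ≤-refl; ≤-trans; ≤-<-trans; <-irrefl; <⇒≤; ≰⇒>; m≤m+n; m≤n+m)
open import Data.Product.Base as Product using (_×_; _,_; ∃; Σ-syntax; proj₁; proj₂)
open import Data.Sum.Base using (_⊎_; inj₁; inj₂; [_,_]′)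
open import Data.Unit.Polymorphic.Base using (tt)
open import Data.Vec.Base as Vec using (Vec; []; _∷_)
open import Data.Vec.Membership.Propositional using () renaming (_∈_ to _∈ᵛ_)
open import Data.Vec.Relation.Binary.Pointwise.Inductive using (Pointwise; []; _∷_)
import Data.Vec.Relation.Unary.Any as Any
open import Function.Base using (id; _∘_; const)
open import Function.Bundles using (_⇔_; mk⇔)
open import Level using (Level; 0ℓ; Lift; lift; lower)
open import Relation.Binary.PropositionalEquality
  using (_≡_; _≢_; refl; sym; trans; cong; cong₂; subst; subst₂)
open import Relation.Binary.PropositionalEquality.WithK using (≡-irrelevant)
open import Relation.Nullary using (¬_; Dec; yes; no; does)
open import Relation.Unary using (Pred; _∈_; _⊆_; _∪_; _∖_; ｛_｝)

private variable
  ℓ : Level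
  𝒮 𝒯 : Signature ℓ
  V : Pred Var 0ℓ
  x : Var

form-≡ : {A B : Form 𝒮 V} → expr A ≡ expr B → A ≡ B
form-≡ {A = form A _ _} {form .A _ _} refl = refl

-- Symmetry of alphabetic variance.

private
  VarMatch-sym : ∀ {ρ x y} → VarMatch ρ x y → VarMatch (List.map Product.swap ρ) y x
  VarMatch-sym free         = free
  VarMatch-sym bound        = bound
  VarMatch-sym (skip p q m) = skip q p (VarMatch-sym m)

module _ {𝒮 : Signature ℓ} where

  private
    swaps : List (Var × Var) → List (Var × Var)
    swaps = List.map Product.swap

    TermMatch-sym : ∀ {ρ} {t u : Term 𝒮} → TermMatch ρ t u → TermMatch (swaps ρ) u t
    TermMatch-sym (var m) = var (VarMatch-sym m)
    TermMatch-sym con     = con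

    TermsMatch-sym : ∀ {ρ n} {ts us : Vec (Term 𝒮) n} →
                     Pointwise (TermMatch ρ) ts us → Pointwise (TermMatch (swaps ρ)) us ts
    TermsMatch-sym []       = []
    TermsMatch-sym (m ∷ ms) = TermMatch-sym m ∷ TermsMatch-sym ms

  ExprMatch-sym : ∀ {ρ} {A B : Expr 𝒮} → ExprMatch ρ A B → ExprMatch (swaps ρ) B A
  ExprMatch-sym (atom ms) = atom (TermsMatch-sym ms)
  ExprMatch-sym (un m)    = un (ExprMatch-sym m)
  ExprMatch-sym (bin m n) = bin (ExprMatch-sym m) (ExprMatch-sym n)
  ExprMatch-sym (qu m)    = qu (ExprMatch-sym m)

  -- Finite lists of constants and hypotheses.

  private
    termConstants : ∀ {n} → Vec (Term 𝒮) n → List (Const 𝒮)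
    termConstants []           = []
    termConstants (var _ ∷ ts) = termConstants ts
    termConstants (con c ∷ ts) = c ∷ termConstants ts

    ∈-termConstants : ∀ {n c} (ts : Vec (Term 𝒮) n) → con c ∈ᵛ ts → c ∈ˡ termConstants ts
    ∈-termConstants (con _ ∷ _)  (Any.here refl) = here refl
    ∈-termConstants (var _ ∷ ts) (Any.there p)   = ∈-termConstants ts p
    ∈-termConstants (con _ ∷ ts) (Any.there p)   = there (∈-termConstants ts p)

  constants : Expr 𝒮 → List (Const 𝒮)
  constants (atom P ts) = termConstants ts
  constants (un # A)    = constants A
  constants (bin ⊗ A B) = constants A ++ constants B
  constants (qu Q x A)  = constants A

  ∈-constants : ∀ {c} (A : Expr 𝒮) → c ∈C A → c ∈ˡ constants A
  ∈-constants (atom P ts) p        = ∈-termConstants ts p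
  ∈-constants (un # A)    p        = ∈-constants A p
  ∈-constants (bin ⊗ A B) (inj₁ p) = ∈-++⁺ˡ (∈-constants A p)
  ∈-constants (bin ⊗ A B) (inj₂ p) = ∈-++⁺ʳ (constants A) (∈-constants B p)
  ∈-constants (qu Q x A)  p        = ∈-constants A p

  -- An upper bound for `Hyps d`: discharged hypotheses are kept, so that no equality of sentences
  -- has to be decided. Freshness and compactness need a list, whereas `Hyps d` is only a predicate.
  hypotheses : ∀ {A} → Derivation 𝒮 A → List (Sentence 𝒮)
  hypotheses (hyp A)                  = A ∷ []
  hypotheses (∧I d e)                 = hypotheses d ++ hypotheses e
  hypotheses (∧E₁ _ _ d)              = hypotheses d
  hypotheses (∧E₂ _ _ d)              = hypotheses d
  hypotheses (∨I₁ _ _ d)              = hypotheses d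
  hypotheses (∨I₂ _ _ d)              = hypotheses d
  hypotheses (∨E _ _ d e f)           = hypotheses d ++ hypotheses e ++ hypotheses f
  hypotheses (¬∧I₁ _ _ d)             = hypotheses d
  hypotheses (¬∧I₂ _ _ d)             = hypotheses d
  hypotheses (¬∧E _ _ d e f)          = hypotheses d ++ hypotheses e ++ hypotheses f
  hypotheses (¬∨I _ _ d e)            = hypotheses d ++ hypotheses e
  hypotheses (¬∨E₁ _ _ d)             = hypotheses d
  hypotheses (¬∨E₂ _ _ d)             = hypotheses d
  hypotheses (DNI d)                  = hypotheses d
  hypotheses (DNE d)                  = hypotheses d
  hypotheses (EXP° _ d e f)           = hypotheses d ++ hypotheses e ++ hypotheses f
  hypotheses (PEM° _ d)               = hypotheses d
  hypotheses (Cons _ _ d e)           = hypotheses d ++ hypotheses e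
  hypotheses (Comp _)                 = []
  hypotheses (∀I _ _ _ _ d _ _ _)     = hypotheses d
  hypotheses (∀E _ _ _ d)             = hypotheses d
  hypotheses (∃I _ _ _ d)             = hypotheses d
  hypotheses (∃E _ _ _ d e _ _ _)     = hypotheses d ++ hypotheses e
  hypotheses (¬∀I _ _ _ d)            = hypotheses d
  hypotheses (¬∀E _ _ _ d e _ _ _)    = hypotheses d ++ hypotheses e
  hypotheses (¬∃I _ _ _ d _ _)        = hypotheses d
  hypotheses (¬∃E _ _ _ d)            = hypotheses d
  hypotheses (≈I _)                   = []
  hypotheses (≈E _ _ _ d e)           = hypotheses d ++ hypotheses e
  hypotheses (AV _ d)                 = hypotheses d

  private
    infixr 4 _⊕_
    _⊕_ : {P Q : Set ℓ} {H : Sentence 𝒮} {xs ys : List (Sentence 𝒮)} →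
          (P → H ∈ˡ xs) → (Q → H ∈ˡ ys) → P ⊎ Q → H ∈ˡ xs ++ ys
    _⊕_ {xs = xs} f g = [ ∈-++⁺ˡ ∘ f , ∈-++⁺ʳ xs ∘ g ]′

  Hyps⊆hypotheses : ∀ {A} (d : Derivation 𝒮 A) → Hyps d ⊆ (_∈ˡ hypotheses d)
  Hyps⊆hypotheses (hyp A)               = λ { refl → here refl }
  Hyps⊆hypotheses (∧I d e)              = Hyps⊆hypotheses d ⊕ Hyps⊆hypotheses e
  Hyps⊆hypotheses (∧E₁ _ _ d)           = Hyps⊆hypotheses d
  Hyps⊆hypotheses (∧E₂ _ _ d)           = Hyps⊆hypotheses d
  Hyps⊆hypotheses (∨I₁ _ _ d)           = Hyps⊆hypotheses d
  Hyps⊆hypotheses (∨I₂ _ _ d)           = Hyps⊆hypotheses d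
  Hyps⊆hypotheses (∨E _ _ d e f)        =
    Hyps⊆hypotheses d ⊕ (Hyps⊆hypotheses e ∘ proj₁) ⊕ (Hyps⊆hypotheses f ∘ proj₁)
  Hyps⊆hypotheses (¬∧I₁ _ _ d)          = Hyps⊆hypotheses d
  Hyps⊆hypotheses (¬∧I₂ _ _ d)          = Hyps⊆hypotheses d
  Hyps⊆hypotheses (¬∧E _ _ d e f)       =
    Hyps⊆hypotheses d ⊕ (Hyps⊆hypotheses e ∘ proj₁) ⊕ (Hyps⊆hypotheses f ∘ proj₁)
  Hyps⊆hypotheses (¬∨I _ _ d e)         = Hyps⊆hypotheses d ⊕ Hyps⊆hypotheses e
  Hyps⊆hypotheses (¬∨E₁ _ _ d)          = Hyps⊆hypotheses d
  Hyps⊆hypotheses (¬∨E₂ _ _ d)          = Hyps⊆hypotheses d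
  Hyps⊆hypotheses (DNI d)               = Hyps⊆hypotheses d
  Hyps⊆hypotheses (DNE d)               = Hyps⊆hypotheses d
  Hyps⊆hypotheses (EXP° _ d e f)        =
    Hyps⊆hypotheses d ⊕ Hyps⊆hypotheses e ⊕ Hyps⊆hypotheses f
  Hyps⊆hypotheses (PEM° _ d)            = Hyps⊆hypotheses d
  Hyps⊆hypotheses (Cons _ _ d e)        = Hyps⊆hypotheses d ⊕ Hyps⊆hypotheses e
  Hyps⊆hypotheses (Comp _)              = λ ()
  Hyps⊆hypotheses (∀I _ _ _ _ d _ _ _)  = Hyps⊆hypotheses d
  Hyps⊆hypotheses (∀E _ _ _ d)          = Hyps⊆hypotheses d
  Hyps⊆hypotheses (∃I _ _ _ d)          = Hyps⊆hypotheses d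
  Hyps⊆hypotheses (∃E _ _ _ d e _ _ _)  = Hyps⊆hypotheses d ⊕ (Hyps⊆hypotheses e ∘ proj₁)
  Hyps⊆hypotheses (¬∀I _ _ _ d)         = Hyps⊆hypotheses d
  Hyps⊆hypotheses (¬∀E _ _ _ d e _ _ _) = Hyps⊆hypotheses d ⊕ (Hyps⊆hypotheses e ∘ proj₁)
  Hyps⊆hypotheses (¬∃I _ _ _ d _ _)     = Hyps⊆hypotheses d
  Hyps⊆hypotheses (¬∃E _ _ _ d)         = Hyps⊆hypotheses d
  Hyps⊆hypotheses (≈I _)                = λ ()
  Hyps⊆hypotheses (≈E _ _ _ d e)        = Hyps⊆hypotheses d ⊕ Hyps⊆hypotheses e
  Hyps⊆hypotheses (AV _ d)              = Hyps⊆hypotheses d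

-- Admissible rules

Avoids : {𝒮 : Signature ℓ} → Const 𝒮 → Pred (Sentence 𝒮) ℓ → Set ℓ
Avoids c Γ = ∀ {H} → H ∈ Γ → ¬ (c occursIn H)

module _ {𝒮 : Signature ℓ} where

  private variable
    Γ Δ : Pred (Sentence 𝒮) ℓ
    A B C : Sentence 𝒮

  weaken : Γ ⊆ Δ → Γ ⊢ A → Δ ⊢ A
  weaken Γ⊆Δ (d , s) = d , λ h → Γ⊆Δ (s h)

  assume : A ∈ Γ → Γ ⊢ A
  assume A∈Γ = hyp _ , λ { refl → A∈Γ }

  ∨-intro₁ : ∀ A B → Γ ⊢ A → Γ ⊢ A ∨̇ B
  ∨-intro₁ A B (d , i) = ∨I₁ A B d , i

  ∨-intro₂ : ∀ A B → Γ ⊢ B → Γ ⊢ A ∨̇ B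
  ∨-intro₂ A B (d , i) = ∨I₂ A B d , i

  ∪-monoˡ : ∀ A → Γ ⊆ Δ → Γ ∪ ｛ A ｝ ⊆ Δ ∪ ｛ A ｝
  ∪-monoˡ A Γ⊆Δ (inj₁ p) = inj₁ (Γ⊆Δ p)
  ∪-monoˡ A Γ⊆Δ (inj₂ p) = inj₂ p

  private
    discharge : ∀ {P H : Set ℓ} {Q : Set ℓ} → (P → Q ⊎ H) → P × ¬ H → Q
    discharge s (p , ¬h) with s p
    ... | inj₁ q = q
    ... | inj₂ h = ⊥-elim (¬h h)

  ∨-elim : ∀ A B → Γ ⊢ A ∨̇ B → Γ ∪ ｛ A ｝ ⊢ C → Γ ∪ ｛ B ｝ ⊢ C → Γ ⊢ C
  ∨-elim A B (d , i) (e , j) (f , k) = ∨E A B d e f , [ i , [ discharge j , discharge k ]′ ]′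

  ¬∧-elim : ∀ A B → Γ ⊢ ¬̇ (A ∧̇ B) → Γ ∪ ｛ ¬̇ A ｝ ⊢ C → Γ ∪ ｛ ¬̇ B ｝ ⊢ C → Γ ⊢ C
  ¬∧-elim A B (d , i) (e , j) (f , k) = ¬∧E A B d e f , [ i , [ discharge j , discharge k ]′ ]′

  -- Without an implication, `A` is weakened to `A ∨̇ A` and eliminated with the same derivation in
  -- both branches.
  cut : Γ ⊢ A → Γ ∪ ｛ A ｝ ⊢ B → Γ ⊢ B
  cut {A = A} p q = ∨-elim A A (∨-intro₁ A A p) q q

  ∀-intro : ∀ B (A : Form 𝒮 ｛ x ｝) .(x∈A : x ∈FV expr A) c →
            ¬ (c occursIn A) → ¬ (c occursIn B) → Avoids c Γ →
            Γ ⊢ B ∨̇ A ⟨ c ⟩ → Γ ⊢ B ∨̇ ∀̇ A x∈A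
  ∀-intro B A x∈A c c∉A c∉B c∉Γ (d , i) = ∀I B A x∈A c d c∉A c∉B (λ h → c∉Γ (i h)) , i

  ¬∃-intro : ∀ (A : Form 𝒮 ｛ x ｝) .(x∈A : x ∈FV expr A) c →
             ¬ (c occursIn A) → Avoids c Γ →
             Γ ⊢ ¬̇ (A ⟨ c ⟩) → Γ ⊢ ¬̇ (∃̇ A x∈A)
  ¬∃-intro A x∈A c c∉A c∉Γ (d , i) = ¬∃I A x∈A c d c∉A (λ h → c∉Γ (i h)) , i

  -- The proviso concerns the hypotheses of the minor premise only. These are collected in `Δ`,
  -- while `Γ`, which also supports the major premise, may contain `c`.
  ∃-elim : ∀ (A : Form 𝒮 ｛ x ｝) .(x∈A : x ∈FV expr A) c →
           ¬ (c occursIn A) → ¬ (c occursIn C) → Avoids c Δ → Δ ⊆ Γ →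
           Γ ⊢ ∃̇ A x∈A → Δ ∪ ｛ A ⟨ c ⟩ ｝ ⊢ C → Γ ⊢ C
  ∃-elim A x∈A c c∉A c∉C c∉Δ Δ⊆Γ (d , i) (e , j) =
    ∃E A x∈A c d e c∉A c∉C (λ h → c∉Δ (discharge j h)) , [ i , (λ h → Δ⊆Γ (discharge j h)) ]′

  ¬∀-elim : ∀ (A : Form 𝒮 ｛ x ｝) .(x∈A : x ∈FV expr A) c →
            ¬ (c occursIn A) → ¬ (c occursIn C) → Avoids c Δ → Δ ⊆ Γ →
            Γ ⊢ ¬̇ (∀̇ A x∈A) → Δ ∪ ｛ ¬̇ (A ⟨ c ⟩) ｝ ⊢ C → Γ ⊢ C
  ¬∀-elim A x∈A c c∉A c∉C c∉Δ Δ⊆Γ (d , i) (e , j) =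
    ¬∀E A x∈A c d e c∉A c∉C (λ h → c∉Δ (discharge j h)) , [ i , (λ h → Δ⊆Γ (discharge j h)) ]′

-- Renaming of constants

module Renaming {𝒮 𝒯 : Signature ℓ} (g : ∀ {n} → Letter 𝒮 n → Letter 𝒯 n) where

  private
    mapTerms : (Const 𝒮 → Const 𝒯) → ∀ {n} → Vec (Term 𝒮) n → Vec (Term 𝒯) n
    mapTerms f = Vec.map (mapTerm {𝒮′ = 𝒯} f)

  rename : (Const 𝒮 → Const 𝒯) → Form 𝒮 V → Form 𝒯 V
  rename f (form A p s) =
    form (mapExpr f g A) (IsFormula-map f g A p) (λ y∈ → s (FV-map⁻ {𝒮′ = 𝒯} f g A y∈))

  private
    mapTerm-subst : ∀ f (t : Term 𝒮) c x →
      mapTerm {𝒮′ = 𝒯} f (substTerm t c x) ≡ substTerm (mapTerm f t) (f c) x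
    mapTerm-subst f (con d) c x = refl
    mapTerm-subst f (var y) c x with x ≟ y
    ... | yes _ = refl
    ... | no _  = refl

    mapTerms-subst : ∀ f {n} (ts : Vec (Term 𝒮) n) c x →
      mapTerms f (Vec.map (λ t → substTerm t c x) ts) ≡
      Vec.map (λ t → substTerm t (f c) x) (mapTerms f ts)
    mapTerms-subst f []       c x = refl
    mapTerms-subst f (t ∷ ts) c x = cong₂ _∷_ (mapTerm-subst f t c x) (mapTerms-subst f ts c x)

    mapExpr-subst : ∀ f (A : Expr 𝒮) c x →
      mapExpr {𝒮′ = 𝒯} f g (A [ c / x ]) ≡ mapExpr f g A [ f c / x ]
    mapExpr-subst f (atom P ts) c x = cong (atom (g P)) (mapTerms-subst f ts c x)
    mapExpr-subst f (un # A)    c x = cong (un #) (mapExpr-subst f A c x)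
    mapExpr-subst f (bin ⊗ A B) c x = cong₂ (bin ⊗) (mapExpr-subst f A c x) (mapExpr-subst f B c x)
    mapExpr-subst f (qu Q y A)  c x with x ≟ y
    ... | yes _ = refl
    ... | no _  = cong (qu Q y) (mapExpr-subst f A c x)

  rename-⟨⟩ : ∀ f (A : Form 𝒮 ｛ x ｝) c → rename f (A ⟨ c ⟩) ≡ rename f A ⟨ f c ⟩
  rename-⟨⟩ {x = x} f A c = form-≡ (mapExpr-subst f (expr A) c x)

  private
    mapTerms-cong : ∀ {f f′ n} (ts : Vec (Term 𝒮) n) →
      (∀ {c} → con c ∈ᵛ ts → f c ≡ f′ c) → mapTerms f ts ≡ mapTerms f′ ts
    mapTerms-cong []           eq = refl
    mapTerms-cong (var y ∷ ts) eq = cong (var y ∷_) (mapTerms-cong ts (eq ∘ Any.there))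
    mapTerms-cong (con c ∷ ts) eq =
      cong₂ (λ d us → con d ∷ us) (eq (Any.here refl)) (mapTerms-cong ts (eq ∘ Any.there))

    mapExpr-cong : ∀ {f f′} (A : Expr 𝒮) →
      (∀ {c} → c ∈C A → f c ≡ f′ c) → mapExpr {𝒮′ = 𝒯} f g A ≡ mapExpr f′ g A
    mapExpr-cong (atom P ts) eq = cong (atom (g P)) (mapTerms-cong ts eq)
    mapExpr-cong (un # A)    eq = cong (un #) (mapExpr-cong A eq)
    mapExpr-cong (bin ⊗ A B) eq =
      cong₂ (bin ⊗) (mapExpr-cong A (eq ∘ inj₁)) (mapExpr-cong B (eq ∘ inj₂))
    mapExpr-cong (qu Q y A)  eq = cong (qu Q y) (mapExpr-cong A eq)

  rename-cong : ∀ {f f′} (A : Form 𝒮 V) →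
    (∀ {c} → c occursIn A → f c ≡ f′ c) → rename f A ≡ rename f′ A
  rename-cong A eq = form-≡ (mapExpr-cong (expr A) eq)

  private
    TermsMatch-map : ∀ f {ρ n} {ts us : Vec (Term 𝒮) n} →
      Pointwise (TermMatch ρ) ts us → Pointwise (TermMatch ρ) (mapTerms f ts) (mapTerms f us)
    TermsMatch-map f []           = []
    TermsMatch-map f (var m ∷ ms) = var m ∷ TermsMatch-map f ms
    TermsMatch-map f (con ∷ ms)   = con ∷ TermsMatch-map f ms

  ExprMatch-map : ∀ f {ρ} {A B : Expr 𝒮} →
    ExprMatch ρ A B → ExprMatch {𝒮 = 𝒯} ρ (mapExpr f g A) (mapExpr f g B)
  ExprMatch-map f (atom ms) = atom (TermsMatch-map f ms)
  ExprMatch-map f (un m)    = un (ExprMatch-map f m)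
  ExprMatch-map f (bin m n) = bin (ExprMatch-map f m) (ExprMatch-map f n)
  ExprMatch-map f (qu m)    = qu (ExprMatch-map f m)

-- Freshness and compactness

module _ (em : ExcludedMiddle ℓ) where

  module _ {𝒮 : Signature ℓ} where

    -- `Infinite` merely denies an enumeration, so the constant is found by contradiction: otherwise
    -- `cs` would list them all.
    fresh : (cs : List (Const 𝒮)) → ∃ λ c → ¬ c ∈ˡ cs
    fresh cs with em {∃ λ c → ¬ c ∈ˡ cs}
    ... | yes p = p
    ... | no ¬p = ⊥-elim (infinite 𝒮 (cs , enumerates))
      where
      enumerates : ∀ c → c ∈ˡ cs
      enumerates c with em {c ∈ˡ cs}
      ... | yes p = p
      ... | no ¬q = ⊥-elim (¬p (c , ¬q))

    freshFor : (Hs : List (Sentence 𝒮)) → ∃ λ c → ∀ {H} → H ∈ˡ Hs → ¬ (c occursIn H)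
    freshFor Hs with fresh (concatMap (constants ∘ expr) Hs)
    ... | c , c∉ = c , λ {H} H∈ c∈H →
      c∉ (∈-concatMap⁺ (constants ∘ expr) (AnyL.map (λ { refl → ∈-constants (expr H) c∈H }) H∈))

    -- The list `hypotheses d` may contain discharged sentences outside `Γ`. Filtering by membership
    -- in `Γ` loses no undischarged hypothesis.
    compact : {Γ : Pred (Sentence 𝒮) ℓ} {A : Sentence 𝒮} → Γ ⊢ A →
              ∃ λ Hs → (_∈ˡ Hs) ⊆ Γ × (_∈ˡ Hs) ⊢ A
    compact {Γ = Γ} (d , s) = filter (λ H → em {Γ H}) (hypotheses d) ,
      (λ h → proj₂ (∈-filter⁻ (λ H → em {Γ H}) {xs = hypotheses d} h)) ,
      (d , λ h → ∈-filter⁺ (λ H → em {Γ H}) (Hyps⊆hypotheses d h) (s h))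

  -- Derivability under renaming.

  module _ {𝒮 𝒯 : Signature ℓ} (g : ∀ {n} → Letter 𝒮 n → Letter 𝒯 n)
           (g-identity : g (identity 𝒮) ≡ identity 𝒯) where
    open Renaming {𝒮 = 𝒮} {𝒯 = 𝒯} g

    private
      _[_↦_] : (Const 𝒮 → Const 𝒯) → Const 𝒮 → Const 𝒯 → Const 𝒮 → Const 𝒯
      (f [ c ↦ c′ ]) d with em {d ≡ c}
      ... | yes _ = c′
      ... | no _  = f d

      updated : ∀ f c c′ → (f [ c ↦ c′ ]) c ≡ c′
      updated f c c′ with em {c ≡ c}
      ... | yes _  = refl
      ... | no c≢c = ⊥-elim (c≢c refl)

      rename-update : ∀ f c c′ (A : Form 𝒮 V) → ¬ (c occursIn A) →
                      rename (f [ c ↦ c′ ]) A ≡ rename f A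
      rename-update f c c′ A c∉A = rename-cong A agree
        where
        agree : ∀ {d} → d occursIn A → (f [ c ↦ c′ ]) d ≡ f d
        agree {d} d∈A with em {d ≡ c}
        ... | yes refl = ⊥-elim (c∉A d∈A)
        ... | no _     = refl

      rename-update-⟨⟩ : ∀ f c c′ (A : Form 𝒮 ｛ x ｝) → ¬ (c occursIn A) →
                         rename (f [ c ↦ c′ ]) (A ⟨ c ⟩) ≡ rename f A ⟨ c′ ⟩
      rename-update-⟨⟩ f c c′ A c∉A =
        trans (rename-⟨⟩ (f [ c ↦ c′ ]) A c)
              (cong₂ _⟨_⟩ (rename-update f c c′ A c∉A) (updated f c c′))

      -- An arbitrary `Γ` may contain every constant. The provisos of the quantifier rules are
      -- therefore met over the image of the hypotheses of one derivation, which involves finitely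
      -- many constants, and the result is weakened to `Γ`.
      Image : (Const 𝒮 → Const 𝒯) → Pred (Sentence 𝒮) ℓ → Pred (Sentence 𝒯) ℓ
      Image f Γ B = ∃ λ H → Γ H × rename f H ≡ B

      -- For rules that discharge `B`: excluded middle decides which hypotheses are `B` and go to
      -- the added assumption.
      except : ∀ {P : Pred (Sentence 𝒮) ℓ} (Γ : Pred (Sentence 𝒯) ℓ) f B →
        (∀ {H} → (P ∖ ｛ B ｝) H → Γ (rename f H)) →
        ∀ {H} → P H → (Γ ∪ ｛ rename f B ｝) (rename f H)
      except Γ f B s {H} p with em {B ≡ H}
      ... | yes refl = inj₂ refl
      ... | no B≢H   = inj₁ (s (p , B≢H))

      image : ∀ (P : Pred (Sentence 𝒮) ℓ) f c c′ → Avoids c P →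
        ∀ {H} → P H → Image f P (rename (f [ c ↦ c′ ]) H)
      image P f c c′ c∉P {H} p = H , p , sym (rename-update f c c′ H (c∉P {H} p))

    -- The renaming need not be injective: each eigenconstant is sent to a
    -- fresh constant instead of its given value.
    ⊢-rename : ∀ f {Γ : Pred (Sentence 𝒯) ℓ} {A} (d : Derivation 𝒮 A) →
               (∀ {H} → Hyps d H → Γ (rename f H)) → Γ ⊢ rename f A

    private
      freshImage : ∀ f (A : Form 𝒮 ｛ x ｝) .(x∈A : x ∈FV expr A) B {C} (d : Derivation 𝒮 C) →
        ∃ λ c → ¬ (c occursIn rename f A) × ¬ (c occursIn rename f B) ×
                (∀ {P} → P ⊆ Hyps d → Avoids c (Image f P))
      freshImage f A x∈A B d
        -- `freshFor` takes sentences, so `A` is closed by a quantifier, which leaves its constants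
        -- as they are.
        with freshFor (rename f (∀̇ A x∈A) ∷ rename f B ∷ List.map (rename f) (hypotheses d))
      ... | c , c∉ = c , c∉ (here refl) , c∉ (there (here refl)) ,
        λ { P⊆ (H , h , refl) → c∉ (there (there (∈-map⁺ (rename f) (Hyps⊆hypotheses d (P⊆ h))))) }

    ⊢-rename f (hyp A) s = assume (s refl)
    ⊢-rename f (∧I d e) s with ⊢-rename f d (s ∘ inj₁) | ⊢-rename f e (s ∘ inj₂)
    ... | d′ , i | e′ , j = ∧I d′ e′ , [ i , j ]′
    ⊢-rename f (∧E₁ A B d) s with ⊢-rename f d s
    ... | d′ , i = ∧E₁ (rename f A) (rename f B) d′ , i
    ⊢-rename f (∧E₂ A B d) s with ⊢-rename f d s
    ... | d′ , i = ∧E₂ (rename f A) (rename f B) d′ , i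
    ⊢-rename f (∨I₁ A B d) s = ∨-intro₁ (rename f A) (rename f B) (⊢-rename f d s)
    ⊢-rename f (∨I₂ A B d) s = ∨-intro₂ (rename f A) (rename f B) (⊢-rename f d s)
    ⊢-rename f {Γ} (∨E A B d d₁ d₂) s =
      ∨-elim (rename f A) (rename f B) (⊢-rename f d (s ∘ inj₁))
        (⊢-rename f d₁ (except Γ f A (s ∘ inj₂ ∘ inj₁)))
        (⊢-rename f d₂ (except Γ f B (s ∘ inj₂ ∘ inj₂)))
    ⊢-rename f (¬∧I₁ A B d) s with ⊢-rename f d s
    ... | d′ , i = ¬∧I₁ (rename f A) (rename f B) d′ , i
    ⊢-rename f (¬∧I₂ A B d) s with ⊢-rename f d s
    ... | d′ , i = ¬∧I₂ (rename f A) (rename f B) d′ , i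
    ⊢-rename f {Γ} (¬∧E A B d d₁ d₂) s =
      ¬∧-elim (rename f A) (rename f B) (⊢-rename f d (s ∘ inj₁))
        (⊢-rename f d₁ (except Γ f (¬̇ A) (s ∘ inj₂ ∘ inj₁)))
        (⊢-rename f d₂ (except Γ f (¬̇ B) (s ∘ inj₂ ∘ inj₂)))
    ⊢-rename f (¬∨I A B d e) s with ⊢-rename f d (s ∘ inj₁) | ⊢-rename f e (s ∘ inj₂)
    ... | d′ , i | e′ , j = ¬∨I (rename f A) (rename f B) d′ e′ , [ i , j ]′
    ⊢-rename f (¬∨E₁ A B d) s with ⊢-rename f d s
    ... | d′ , i = ¬∨E₁ (rename f A) (rename f B) d′ , i
    ⊢-rename f (¬∨E₂ A B d) s with ⊢-rename f d s
    ... | d′ , i = ¬∨E₂ (rename f A) (rename f B) d′ , i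
    ⊢-rename f (DNI d) s with ⊢-rename f d s
    ... | d′ , i = DNI d′ , i
    ⊢-rename f (DNE {A} d) s with ⊢-rename f d s
    ... | d′ , i = DNE {A = rename f A} d′ , i
    ⊢-rename f (EXP° {A} B d e k) s
      with ⊢-rename f d (s ∘ inj₁) | ⊢-rename f e (s ∘ inj₂ ∘ inj₁) | ⊢-rename f k (s ∘ inj₂ ∘ inj₂)
    ... | d′ , i | e′ , j | k′ , l = EXP° {A = rename f A} (rename f B) d′ e′ k′ , [ i , [ j , l ]′ ]′
    ⊢-rename f (PEM° A d) s with ⊢-rename f d s
    ... | d′ , i = PEM° (rename f A) d′ , i
    ⊢-rename f (Cons A B d e) s with ⊢-rename f d (s ∘ inj₁) | ⊢-rename f e (s ∘ inj₂)
    ... | d′ , i | e′ , j = Cons (rename f A) (rename f B) d′ e′ , [ i , j ]′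
    ⊢-rename f (Comp A) s = Comp (rename f A) , λ ()
    -- Redirecting the eigenconstant `c` to the fresh `c′` changes only the image of `A ⟨ c ⟩`,
    -- because `c` is absent from `A`, `B` and the hypotheses. The other rules with a proviso are
    -- treated alike.
    ⊢-rename f {Γ} (∀I B A x∈A c d c∉A c∉B c∉d) s with freshImage f A x∈A B d
    ... | c′ , c′∉A , c′∉B , c′∉d =
      weaken (λ { (_ , h , refl) → s h })
        (∀-intro (rename f B) (rename f A) (FV-map⁺ f g (expr A) x∈A) c′ c′∉A c′∉B (c′∉d id)
          (subst (Image f (Hyps d) ⊢_)
            (cong₂ _∨̇_ (rename-update f c c′ B c∉B) (rename-update-⟨⟩ f c c′ A c∉A))
            (⊢-rename (f [ c ↦ c′ ]) d (image (Hyps d) f c c′ c∉d))))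
    ⊢-rename f {Γ} (∀E A x∈A c d) s with ⊢-rename f d s
    ... | d′ , i = subst (Γ ⊢_) (sym (rename-⟨⟩ f A c))
      (∀E (rename f A) (FV-map⁺ f g (expr A) x∈A) (f c) d′ , i)
    ⊢-rename f {Γ} (∃I A x∈A c d) s with subst (Γ ⊢_) (rename-⟨⟩ f A c) (⊢-rename f d s)
    ... | d′ , i = ∃I (rename f A) (FV-map⁺ f g (expr A) x∈A) (f c) d′ , i
    ⊢-rename f {Γ} (∃E {C = C} A x∈A c d e c∉A c∉C c∉e) s with freshImage f A x∈A C e
    ... | c′ , c′∉A , c′∉C , c′∉e =
      ∃-elim (rename f A) (FV-map⁺ f g (expr A) x∈A) c′ c′∉A c′∉C (c′∉e proj₁)
        (λ { (_ , h , refl) → s (inj₂ h) })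
        (⊢-rename f d (s ∘ inj₁))
        (subst₂ (λ D → Image f (Hyps e ∖ ｛ A ⟨ c ⟩ ｝) ∪ ｛ D ｝ ⊢_)
          (rename-update-⟨⟩ f c c′ A c∉A) (rename-update f c c′ C c∉C)
          (⊢-rename (f [ c ↦ c′ ]) e
            (except (Image f (Hyps e ∖ ｛ A ⟨ c ⟩ ｝)) (f [ c ↦ c′ ]) (A ⟨ c ⟩)
              (image (Hyps e ∖ ｛ A ⟨ c ⟩ ｝) f c c′ (λ {H} → c∉e {H})))))
    ⊢-rename f {Γ} (¬∀I A x∈A c d) s
      with subst (Γ ⊢_) (cong ¬̇_ (rename-⟨⟩ f A c)) (⊢-rename f d s)
    ... | d′ , i = ¬∀I (rename f A) (FV-map⁺ f g (expr A) x∈A) (f c) d′ , i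
    ⊢-rename f {Γ} (¬∀E {C = C} A x∈A c d e c∉A c∉C c∉e) s with freshImage f A x∈A C e
    ... | c′ , c′∉A , c′∉C , c′∉e =
      ¬∀-elim (rename f A) (FV-map⁺ f g (expr A) x∈A) c′ c′∉A c′∉C (c′∉e proj₁)
        (λ { (_ , h , refl) → s (inj₂ h) })
        (⊢-rename f d (s ∘ inj₁))
        (subst₂ (λ D → Image f (Hyps e ∖ ｛ ¬̇ (A ⟨ c ⟩) ｝) ∪ ｛ D ｝ ⊢_)
          (cong ¬̇_ (rename-update-⟨⟩ f c c′ A c∉A)) (rename-update f c c′ C c∉C)
          (⊢-rename (f [ c ↦ c′ ]) e
            (except (Image f (Hyps e ∖ ｛ ¬̇ (A ⟨ c ⟩) ｝)) (f [ c ↦ c′ ]) (¬̇ (A ⟨ c ⟩))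
              (image (Hyps e ∖ ｛ ¬̇ (A ⟨ c ⟩) ｝) f c c′ (λ {H} → c∉e {H})))))
    ⊢-rename f {Γ} (¬∃I A x∈A c d c∉A c∉d) s with freshImage f A x∈A (∃̇ A x∈A) d
    ... | c′ , c′∉A , _ , c′∉d =
      weaken (λ { (_ , h , refl) → s h })
        (¬∃-intro (rename f A) (FV-map⁺ f g (expr A) x∈A) c′ c′∉A (c′∉d id)
          (subst (Image f (Hyps d) ⊢_) (cong ¬̇_ (rename-update-⟨⟩ f c c′ A c∉A))
            (⊢-rename (f [ c ↦ c′ ]) d (image (Hyps d) f c c′ c∉d))))
    ⊢-rename f {Γ} (¬∃E A x∈A c d) s with ⊢-rename f d s
    ... | d′ , i = subst (Γ ⊢_) (cong ¬̇_ (sym (rename-⟨⟩ f A c)))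
      (¬∃E (rename f A) (FV-map⁺ f g (expr A) x∈A) (f c) d′ , i)
    ⊢-rename f {Γ} (≈I c) s =
      subst (λ P → Γ ⊢ atomic P (f c ∷ f c ∷ [])) (sym g-identity) (≈I (f c) , λ ())
    ⊢-rename f {Γ} (≈E A c₁ c₂ d e) s
      with subst (λ P → Γ ⊢ atomic P (f c₁ ∷ f c₂ ∷ [])) g-identity (⊢-rename f d (s ∘ inj₁))
         | subst (Γ ⊢_) (rename-⟨⟩ f A c₁) (⊢-rename f e (s ∘ inj₂))
    ... | d′ , i | e′ , j = subst (Γ ⊢_) (sym (rename-⟨⟩ f A c₂))
      (≈E (rename f A) (f c₁) (f c₂) d′ e′ , [ i , j ]′)
    ⊢-rename f (AV {A} {A′} A∼A′ d) s with ⊢-rename f d s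
    ... | d′ , i = AV {A = rename f A} {A′ = rename f A′} (ExprMatch-map f A∼A′) d′ , i

-- A maximality principle

module Tukey (em : ExcludedMiddle ℓ) (ext : Extensionality ℓ ℓ)
             {S : Set ℓ} (Bad : List S → Set ℓ) where

  Subset : Set ℓ
  Subset = S → Bool

  private
    ⌊_⌋ : Set ℓ → Bool
    ⌊ P ⌋ = does (em {P})

    ⌊⌋-true : {P : Set ℓ} → P → ⌊ P ⌋ ≡ true
    ⌊⌋-true {P} p with em {P}
    ... | yes _ = refl
    ... | no ¬p = ⊥-elim (¬p p)

    true-⌊⌋ : {P : Set ℓ} → ⌊ P ⌋ ≡ true → P
    true-⌊⌋ {P} eq with em {P}
    ... | yes p = p

  infix 4 _∋_ _⊑_

  _∋_ : Subset → S → Set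
  M ∋ s = M s ≡ true

  _⊑_ : Subset → Subset → Set ℓ
  M ⊑ N = ∀ {s} → M ∋ s → N ∋ s

  private
    ⊑-antisym : ∀ {M N} → M ⊑ N → N ⊑ M → M ≡ N
    ⊑-antisym {M} {N} M⊑N N⊑M = lower-extensionality ℓ ℓ ext agree
      where
      agree : ∀ s → M s ≡ N s
      agree s with M s in p | N s in q
      ... | true  | true  = refl
      ... | false | false = refl
      ... | true  | false = trans (sym (M⊑N p)) q
      ... | false | true  = trans (sym p) (N⊑M q)

    _⊹_ : Subset → S → Subset
    (M ⊹ s) t = M t ∨ ⌊ s ≡ t ⌋

    +⁻ : ∀ M {s t} → (M ⊹ s) ∋ t → M ∋ t ⊎ s ≡ t
    +⁻ M {t = t} p with M t
    ... | true  = inj₁ refl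
    ... | false = inj₂ (true-⌊⌋ p)

    +ˡ : ∀ M s → M ⊑ M ⊹ s
    +ˡ M s p rewrite p = refl

    +ʳ : ∀ M s → (M ⊹ s) ∋ s
    +ʳ M s with M s
    ... | true  = refl
    ... | false = ⌊⌋-true refl

  -- A property of finite character: only finite lists can violate it, which is why it passes to
  -- unions of chains.
  Good : Subset → Set ℓ
  Good M = ∀ {xs} → Bad xs → ¬ (∀ {s} → s ∈ˡ xs → M ∋ s)

  private
    Extensible : Subset → Set ℓ
    Extensible M = ∃ λ s → ¬ (M ∋ s) × Good (M ⊹ s)

    -- `em` is a fixed function, so its answer chooses the element to add. A subset without a good
    -- one-element extension is a fixed point.
    next : Subset → Subset
    next M with em {Extensible M}
    ... | yes (s , _) = M ⊹ s
    ... | no _        = M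

    ⊑-next : ∀ M → M ⊑ next M
    ⊑-next M with em {Extensible M}
    ... | yes (s , _) = +ˡ M s
    ... | no _        = id

    ⋃ : (Subset → Bool) → Subset
    ⋃ 𝒫 s = ⌊ (∃ λ M → 𝒫 M ≡ true × M ∋ s) ⌋

    ⋃⁺ : ∀ 𝒫 {M} → 𝒫 M ≡ true → M ⊑ ⋃ 𝒫
    ⋃⁺ 𝒫 {M} p q = ⌊⌋-true (M , p , q)

    -- Families of subsets are Bool-valued so that Tower stays in Set ℓ,
    -- where it can be decided.
    data Tower : Subset → Set ℓ where
      step  : ∀ {M} → Tower M → Tower (next M)
      union : ∀ 𝒫 → (∀ {M} → 𝒫 M ≡ true → Tower M) → Tower (⋃ 𝒫)

    -- Nothing in the tower lies strictly between `M` and `next M`, by induction on `N`. A union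
    -- either has a member above `next M`, or all its members, hence the union, lie below `M`.
    squeeze : ∀ {M N} → Tower N → (∀ {N} → Tower N → M ⊑ N ⊎ next N ⊑ M) →
              M ⊑ N → N ≡ M ⊎ next M ⊑ N
    squeeze {M} (step {N} n) cmp M⊑N with cmp n
    ... | inj₂ N⊑M = inj₁ (⊑-antisym N⊑M M⊑N)
    ... | inj₁ M⊑N′ with squeeze n cmp M⊑N′
    ...   | inj₁ refl = inj₂ id
    ...   | inj₂ p    = inj₂ (⊑-next N ∘ p)
    squeeze {M} (union 𝒫 towers) cmp M⊑⋃ with em {∃ λ N → 𝒫 N ≡ true × next M ⊑ N}
    ... | yes (N , N∈ , p) = inj₂ (⋃⁺ 𝒫 N∈ ∘ p)
    ... | no ¬above        = inj₁ (⊑-antisym ⋃⊑M M⊑⋃)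
      where
      member : ∀ {N} → 𝒫 N ≡ true → N ⊑ M
      member {N} N∈ with cmp (towers N∈)
      ... | inj₂ p = p ∘ ⊑-next N
      ... | inj₁ M⊑N with squeeze (towers N∈) cmp M⊑N
      ...   | inj₁ refl = id
      ...   | inj₂ p    = ⊥-elim (¬above (N , N∈ , p))
      ⋃⊑M : ⋃ 𝒫 ⊑ M
      ⋃⊑M p with true-⌊⌋ p
      ... | N , N∈ , q = member N∈ q

    -- Induction on `M`: the comparability of `M` with the whole tower is what `squeeze` requires in
    -- order to treat `next M`.
    compare : ∀ {M N} → Tower M → Tower N → M ⊑ N ⊎ next N ⊑ M
    compare {N = N} (step {M} m) n with compare m n
    ... | inj₂ p = inj₂ (⊑-next M ∘ p)
    ... | inj₁ M⊑N with squeeze n (compare m) M⊑N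
    ...   | inj₁ refl = inj₂ id
    ...   | inj₂ p    = inj₁ p
    compare {N = N} (union 𝒫 towers) n with em {∃ λ M → 𝒫 M ≡ true × ¬ (M ⊑ N)}
    ... | yes (M , M∈ , M⋢N) with compare (towers M∈) n
    ...   | inj₁ M⊑N = ⊥-elim (M⋢N M⊑N)
    ...   | inj₂ p   = inj₂ (⋃⁺ 𝒫 M∈ ∘ p)
    compare {N = N} (union 𝒫 towers) n | no none = inj₁ ⋃⊑N
      where
      ⋃⊑N : ⋃ 𝒫 ⊑ N
      ⋃⊑N p with true-⌊⌋ p
      ... | M , M∈ , q with em {M ⊑ N}
      ...   | yes M⊑N = M⊑N q
      ...   | no M⋢N  = ⊥-elim (none (M , M∈ , M⋢N))

    linear : ∀ {M N} → Tower M → Tower N → M ⊑ N ⊎ N ⊑ M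
    linear {N = N} m n with compare m n
    ... | inj₁ p = inj₁ p
    ... | inj₂ p = inj₂ (p ∘ ⊑-next N)

    -- Finitely many members of a chain are all included in one of them. The empty list is set apart
    -- because the family may be empty.
    finite-⋃ : ∀ 𝒫 → (∀ {M} → 𝒫 M ≡ true → Tower M) →
               ∀ xs → (∀ {s} → s ∈ˡ xs → ⋃ 𝒫 ∋ s) →
               xs ≡ [] ⊎ ∃ λ M → 𝒫 M ≡ true × (∀ {s} → s ∈ˡ xs → M ∋ s)
    finite-⋃ 𝒫 towers []       xs⊆ = inj₁ refl
    finite-⋃ 𝒫 towers (x ∷ xs) xs⊆
      with true-⌊⌋ (xs⊆ (here refl)) | finite-⋃ 𝒫 towers xs (xs⊆ ∘ there)
    ... | M , M∈ , p | inj₁ refl = inj₂ (M , M∈ , λ { (here refl) → p })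
    ... | M , M∈ , p | inj₂ (N , N∈ , q) with linear (towers M∈) (towers N∈)
    ...   | inj₁ M⊑N = inj₂ (N , N∈ , λ { (here refl) → M⊑N p ; (there r) → q r })
    ...   | inj₂ N⊑M = inj₂ (M , M∈ , λ { (here refl) → p ; (there r) → N⊑M (q r) })

    Tower-good : ¬ Bad [] → ∀ {M} → Tower M → Good M
    Tower-good ¬bad (step {M} m) with em {Extensible M}
    ... | yes (_ , _ , good) = good
    ... | no _               = Tower-good ¬bad m
    Tower-good ¬bad (union 𝒫 towers) {xs} bad xs⊆ with finite-⋃ 𝒫 towers xs xs⊆
    ... | inj₁ refl         = ¬bad bad
    ... | inj₂ (M , M∈ , p) = Tower-good ¬bad (towers M∈) bad p

    top : Subset
    top = ⋃ (λ M → ⌊ Tower M ⌋)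

    top-tower : Tower top
    top-tower = union (λ M → ⌊ Tower M ⌋) true-⌊⌋

    -- `next top` is in the tower and so included in the union `top`; an added element would already
    -- belong to `top`.
    top-inextensible : ¬ Extensible top
    top-inextensible e with em {Extensible top} | ⋃⁺ (λ M → ⌊ Tower M ⌋) (⌊⌋-true (step top-tower))
    ... | yes (s , s∉ , _) | p = s∉ (p (+ʳ top s))
    ... | no ¬e            | _ = ¬e e

  maximal : ¬ Bad [] → ∃ λ M → Good M ×
            (∀ s → ¬ (M ∋ s) → ∃ λ xs → Bad xs × (∀ {t} → t ∈ˡ xs → M ∋ t ⊎ s ≡ t))
  maximal ¬bad = top , Tower-good ¬bad top-tower , λ s s∉ → witness s s∉ em
    where
    Witness : S → Set ℓ
    Witness s = ∃ λ xs → Bad xs × (∀ {t} → t ∈ˡ xs → top ∋ t ⊎ s ≡ t)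
    witness : ∀ s → ¬ (top ∋ s) → Dec (Witness s) → Witness s
    witness s s∉ (yes w) = w
    witness s s∉ (no ¬w) = ⊥-elim (top-inextensible
      (s , s∉ , λ {xs} bad xs⊆ → ¬w (xs , bad , λ t∈ → +⁻ top (xs⊆ t∈))))

-- Constants of a substitution instance.

private
  constant-subst : ∀ {𝒮 : Signature ℓ} (A : Expr 𝒮) {c d} → d ∈C A [ c / x ] → d ∈C A ⊎ d ≡ c
  constant-subst {x = x} (atom P ts) = terms ts
    where
    terms : ∀ {n c d} (ts : Vec (Term _) n) →
            con d ∈ᵛ Vec.map (λ t → substTerm t c x) ts → con d ∈ᵛ ts ⊎ d ≡ c
    terms (var y ∷ ts) (Any.here p) with x ≟ y | p
    ... | yes _ | refl = inj₂ refl
    terms (con d ∷ ts) (Any.here refl) = inj₁ (Any.here refl)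
    terms (t ∷ ts)     (Any.there p) with terms ts p
    ... | inj₁ q = inj₁ (Any.there q)
    ... | inj₂ q = inj₂ q
  constant-subst (un # A) p = constant-subst A p
  constant-subst (bin ⊗ A B) (inj₁ p) with constant-subst A p
  ... | inj₁ q = inj₁ (inj₁ q)
  ... | inj₂ q = inj₂ q
  constant-subst (bin ⊗ A B) (inj₂ p) with constant-subst B p
  ... | inj₁ q = inj₁ (inj₂ q)
  ... | inj₂ q = inj₂ q
  constant-subst {x = x} (qu Q y A) p with x ≟ y
  ... | yes _ = inj₁ p
  ... | no _  = constant-subst A p

-- Henkin axioms

data Kind : Set where
  ∃⁺ ∀⁺ ∃⁻ ∀⁻ : Kind

-- The new constants.  A formula is coded by a tree, so that a constant
-- can contain the formula it witnesses.
data Code (𝒮 : Signature ℓ) : Set ℓ where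
  var     : Var → Code 𝒮
  old     : Const 𝒮 → Code 𝒮
  new     : Code 𝒮 → Code 𝒮
  []      : Code 𝒮
  _∷_     : Code 𝒮 → Code 𝒮 → Code 𝒮
  atom    : ∀ {n} → Letter 𝒮 n → Code 𝒮 → Code 𝒮
  un      : Unary → Code 𝒮 → Code 𝒮
  bin     : Binary → Code 𝒮 → Code 𝒮 → Code 𝒮
  qu      : Quantifier → Var → Code 𝒮 → Code 𝒮
  witness : Kind → Var → Code 𝒮 → Code 𝒮

module Henkin (𝒮 : Signature ℓ) where

  𝒮⁺ : Signature ℓ
  𝒮⁺ = extend 𝒮 (Code 𝒮)

  private
    -- Counts the uses of `new`, nested ones included. An added constant thus has a smaller code
    -- than any formula in which it occurs.
    size : Code 𝒮 → ℕ
    size (var x)         = 0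
    size (old c)         = 0
    size (new w)         = suc (size w)
    size []              = 0
    size (v ∷ w)         = size v + size w
    size (atom P w)      = size w
    size (un # w)        = size w
    size (bin ⊗ v w)     = size v + size w
    size (qu Q x w)      = size w
    size (witness k x w) = size w

    encodeTerm : Term 𝒮⁺ → Code 𝒮
    encodeTerm (var x)        = var x
    encodeTerm (con (inj₁ c)) = old c
    encodeTerm (con (inj₂ w)) = new w

    encodeTerms : ∀ {n} → Vec (Term 𝒮⁺) n → Code 𝒮
    encodeTerms []       = []
    encodeTerms (t ∷ ts) = encodeTerm t ∷ encodeTerms ts

    encode : Expr 𝒮⁺ → Code 𝒮
    encode (atom P ts) = atom P (encodeTerms ts)
    encode (un # A)    = un # (encode A)
    encode (bin ⊗ A B) = bin ⊗ (encode A) (encode B)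
    encode (qu Q x A)  = qu Q x (encode A)

    encodeTerms-injective : ∀ {n} (ts us : Vec (Term 𝒮⁺) n) → encodeTerms ts ≡ encodeTerms us → ts ≡ us
    encodeTerms-injective []       []       eq = refl
    encodeTerms-injective (t ∷ ts) (u ∷ us) eq =
      cong₂ _∷_ (head t u eq) (encodeTerms-injective ts us (tail eq))
      where
      head : ∀ t u {v w : Code 𝒮} → (encodeTerm t ∷ v) ≡ (encodeTerm u ∷ w) → t ≡ u
      head (var _)        (var _)        refl = refl
      head (con (inj₁ _)) (con (inj₁ _)) refl = refl
      head (con (inj₂ _)) (con (inj₂ _)) refl = refl
      head (var _) (con (inj₁ _)) ()
      head (var _) (con (inj₂ _)) ()
      tail : ∀ {v w v′ w′ : Code 𝒮} → (v ∷ v′) ≡ (w ∷ w′) → v′ ≡ w′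
      tail refl = refl

    un-injective : ∀ {# #′} {v w : Code 𝒮} → un # v ≡ un #′ w → # ≡ #′ × v ≡ w
    un-injective refl = refl , refl

    bin-injective : ∀ {⊗ ⊗′} {v w v′ w′ : Code 𝒮} →
                    bin ⊗ v w ≡ bin ⊗′ v′ w′ → ⊗ ≡ ⊗′ × v ≡ v′ × w ≡ w′
    bin-injective refl = refl , refl , refl

    qu-injective : ∀ {Q Q′ x x′} {v w : Code 𝒮} → qu Q x v ≡ qu Q′ x′ w → Q ≡ Q′ × x ≡ x′ × v ≡ w
    qu-injective refl = refl , refl , refl

    atom-injective : ∀ {m n} {P : Letter 𝒮 m} {R : Letter 𝒮 n} {v w : Code 𝒮} → atom P v ≡ atom R w →
                     Σ[ eq ∈ m ≡ n ] subst (Letter 𝒮) eq P ≡ R × v ≡ w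
    atom-injective refl = refl , refl , refl

    encode-injective : ∀ A B → encode A ≡ encode B → A ≡ B
    encode-injective (atom P ts) (atom R us) eq with atom-injective eq
    ... | refl , refl , eq′ = cong (atom P) (encodeTerms-injective ts us eq′)
    encode-injective (un # A) (un _ B) eq with un-injective eq
    ... | refl , eq′ = cong (un #) (encode-injective A B eq′)
    encode-injective (bin ⊗ A B) (bin _ C D) eq with bin-injective eq
    ... | refl , p , q = cong₂ (bin ⊗) (encode-injective A C p) (encode-injective B D q)
    encode-injective (qu Q x A) (qu _ _ B) eq with qu-injective eq
    ... | refl , refl , eq′ = cong (qu Q x) (encode-injective A B eq′)

    size-encodeTerms : ∀ {n w} (ts : Vec (Term 𝒮⁺) n) → con (inj₂ w) ∈ᵛ ts → size w < size (encodeTerms ts)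
    size-encodeTerms (t ∷ ts) (Any.here refl) = m≤m+n _ (size (encodeTerms ts))
    size-encodeTerms (t ∷ ts) (Any.there p)   =
      ≤-trans (size-encodeTerms ts p) (m≤n+m _ (size (encodeTerm t)))

    size-encode : ∀ {w} A → inj₂ w ∈C A → size w < size (encode A)
    size-encode (atom P ts) p        = size-encodeTerms ts p
    size-encode (un # A)    p        = size-encode A p
    size-encode (bin ⊗ A B) (inj₁ p) = ≤-trans (size-encode A p) (m≤m+n _ (size (encode B)))
    size-encode (bin ⊗ A B) (inj₂ p) = ≤-trans (size-encode B p) (m≤n+m _ (size (encode A)))
    size-encode (qu Q x A)  p        = size-encode A p

  -- The axioms and their order.

  record Axiom : Set ℓ where
    constructor axiom
    field
      kind  : Kind
      {y}   : Var
      A     : Form 𝒮⁺ ｛ y ｝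
      .y∈A  : y ∈FV expr A

    code : Code 𝒮
    code = witness kind y (encode (expr A))

    constant : Const 𝒮⁺
    constant = inj₂ code

  open Axiom using (code; constant)

  premise conclusion : Axiom → Sentence 𝒮⁺
  premise    h@(axiom ∃⁺ A x∈A) = ∃̇ A x∈A
  premise    h@(axiom ∀⁺ A x∈A) = A ⟨ constant h ⟩
  premise    h@(axiom ∃⁻ A x∈A) = ¬̇ (A ⟨ constant h ⟩)
  premise    h@(axiom ∀⁻ A x∈A) = ¬̇ (∀̇ A x∈A)
  conclusion h@(axiom ∃⁺ A x∈A) = A ⟨ constant h ⟩
  conclusion h@(axiom ∀⁺ A x∈A) = ∀̇ A x∈A
  conclusion h@(axiom ∃⁻ A x∈A) = ¬̇ (∃̇ A x∈A)
  conclusion h@(axiom ∀⁻ A x∈A) = ¬̇ (A ⟨ constant h ⟩)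

  private
    witness-injective : ∀ {k l x y} {v w : Code 𝒮} →
                        witness k x v ≡ witness l y w → k ≡ l × x ≡ y × v ≡ w
    witness-injective refl = refl , refl , refl

    -- The code records kind, variable and matrix, and all other components are irrelevant proofs.
    -- Distinct axioms therefore have distinct constants.
    code-injective : ∀ h k → code h ≡ code k → h ≡ k
    code-injective (axiom _ (form A _ _) _) (axiom _ (form B _ _) _) eq with witness-injective eq
    ... | refl , refl , eq′ with encode-injective A B eq′
    ...   | refl = refl

    infix 4 _≺_
    -- Guarantees that the constant of `k` does not occur in the axiom `h`: it is too large for the
    -- matrix of `h` and differs from the constant of `h`. Distinct axioms of equal size are related
    -- both ways.
    _≺_ : Axiom → Axiom → Set ℓ
    h ≺ k = size (code h) ≤ size (code k) × h ≢ k

    -- A constant in the matrix would have a strictly smaller code. The weak inequality lets the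
    -- case of `h` against itself be included.
    ≺⇒∉-matrix : ∀ {h k} → size (code h) ≤ size (code k) → ¬ (constant k occursIn Axiom.A h)
    ≺⇒∉-matrix {h} h≤k k∈h =
      <-irrefl refl (≤-<-trans h≤k (size-encode (expr (Axiom.A h)) k∈h))

    ≺⇒∉-instance : ∀ {h k} → h ≺ k → ¬ (constant k occursIn (Axiom.A h ⟨ constant h ⟩))
    ≺⇒∉-instance {h} {k} (h≤k , h≢k) k∈h with constant-subst (expr (Axiom.A h)) k∈h
    ... | inj₁ p    = ≺⇒∉-matrix {h} {k} h≤k p
    ... | inj₂ eq = h≢k (sym (code-injective k h (inj₂-injective eq)))
      where
      inj₂-injective : ∀ {v w : Code 𝒮} → inj₂ {A = Const 𝒮} v ≡ inj₂ w → v ≡ w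
      inj₂-injective refl = refl

    ≺⇒∉-premise : ∀ h k → h ≺ k → ¬ (constant k occursIn premise h)
    ≺⇒∉-premise h@(axiom ∃⁺ A x∈A) k h≺k = ≺⇒∉-matrix {h} {k} (proj₁ h≺k)
    ≺⇒∉-premise h@(axiom ∀⁺ A x∈A) k h≺k = ≺⇒∉-instance {h} {k} h≺k
    ≺⇒∉-premise h@(axiom ∃⁻ A x∈A) k h≺k = ≺⇒∉-instance {h} {k} h≺k
    ≺⇒∉-premise h@(axiom ∀⁻ A x∈A) k h≺k = ≺⇒∉-matrix {h} {k} (proj₁ h≺k)

    ≺⇒∉-conclusion : ∀ h k → h ≺ k → ¬ (constant k occursIn conclusion h)
    ≺⇒∉-conclusion h@(axiom ∃⁺ A x∈A) k h≺k = ≺⇒∉-instance {h} {k} h≺k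
    ≺⇒∉-conclusion h@(axiom ∀⁺ A x∈A) k h≺k = ≺⇒∉-matrix {h} {k} (proj₁ h≺k)
    ≺⇒∉-conclusion h@(axiom ∃⁻ A x∈A) k h≺k = ≺⇒∉-matrix {h} {k} (proj₁ h≺k)
    ≺⇒∉-conclusion h@(axiom ∀⁻ A x∈A) k h≺k = ≺⇒∉-instance {h} {k} h≺k

  -- Derivability by means of axioms.

  private variable
    Γ Δ : Pred (Sentence 𝒮⁺) ℓ
    B C R R′ : Sentence 𝒮⁺

  -- An axiom premise → conclusion is used as a case distinction: either its
  -- conclusion is assumed, or its premise becomes an alternative to R.
  infix 3 _⊢[_]_
  _⊢[_]_ : Pred (Sentence 𝒮⁺) ℓ → List Axiom → Sentence 𝒮⁺ → Set ℓ
  Γ ⊢[ [] ]     R = Γ ⊢ R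
  Γ ⊢[ h ∷ hs ] R = (Γ ∪ ｛ conclusion h ｝ ⊢[ hs ] R) × (Γ ⊢[ hs ] R ∨̇ premise h)

  private
    swap : ∀ (Γ : Pred (Sentence 𝒮⁺) ℓ) A B → (Γ ∪ ｛ A ｝) ∪ ｛ B ｝ ⊆ (Γ ∪ ｛ B ｝) ∪ ｛ A ｝
    swap Γ A B (inj₁ (inj₁ p)) = inj₁ (inj₁ p)
    swap Γ A B (inj₁ (inj₂ p)) = inj₂ p
    swap Γ A B (inj₂ p)        = inj₁ (inj₂ p)

    contract : ∀ (Γ : Pred (Sentence 𝒮⁺) ℓ) A → (Γ ∪ ｛ A ｝) ∪ ｛ A ｝ ⊆ Γ ∪ ｛ A ｝
    contract Γ A (inj₁ p) = p
    contract Γ A (inj₂ p) = inj₂ p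

    last : ∀ A → Γ ∪ ｛ A ｝ ⊢ A
    last A = assume (inj₂ refl)

    outer : ∀ A → Γ ⊢ R → Γ ∪ ｛ A ｝ ⊢ R
    outer A = weaken inj₁

    inner : ∀ A B → Γ ∪ ｛ B ｝ ⊢ R → (Γ ∪ ｛ A ｝) ∪ ｛ B ｝ ⊢ R
    inner A B = weaken λ { (inj₁ p) → inj₁ (inj₁ p) ; (inj₂ p) → inj₂ p }

    ∨-case : ∀ A B → Γ ∪ ｛ A ｝ ⊢ R → Γ ∪ ｛ B ｝ ⊢ R → Γ ∪ ｛ A ∨̇ B ｝ ⊢ R
    ∨-case A B p q = ∨-elim A B (last (A ∨̇ B)) (inner (A ∨̇ B) A p) (inner (A ∨̇ B) B q)

  []-weaken : ∀ hs → Γ ⊆ Δ → Γ ⊢[ hs ] R → Δ ⊢[ hs ] R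
  []-weaken []       Γ⊆Δ p       = weaken Γ⊆Δ p
  []-weaken {Γ = Γ} {Δ = Δ} (h ∷ hs) Γ⊆Δ (p , q) =
    []-weaken hs (∪-monoˡ {Γ = Γ} {Δ = Δ} (conclusion h) Γ⊆Δ) p , []-weaken hs Γ⊆Δ q

  []-pure : ∀ hs → Γ ⊢ R → Γ ⊢[ hs ] R
  []-pure         []       p = p
  []-pure {R = R} (h ∷ hs) p = []-pure hs (outer (conclusion h) p) , []-pure hs (∨-intro₁ R (premise h) p)

  []-map : ∀ hs → Γ ∪ ｛ R ｝ ⊢ R′ → Γ ⊢[ hs ] R → Γ ⊢[ hs ] R′
  []-map []       r p = cut p r
  []-map {R = R} {R′ = R′} (h ∷ hs) r (p , q) =
    []-map hs (inner (conclusion h) R r) p ,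
    []-map hs (∨-case R (premise h) (∨-intro₁ R′ (premise h) r)
                (∨-intro₂ R′ (premise h) (last (premise h)))) q

  []-∨-elim : ∀ hs B C → Γ ⊢ B ∨̇ C → Γ ∪ ｛ B ｝ ⊢[ hs ] R → Γ ∪ ｛ C ｝ ⊢[ hs ] R → Γ ⊢[ hs ] R
  []-∨-elim []       B C r p         q         = ∨-elim B C r p q
  []-∨-elim {Γ = Γ} (h ∷ hs) B C r (p₁ , p₂) (q₁ , q₂) =
    []-∨-elim hs B C (outer (conclusion h) r)
      ([]-weaken hs (swap Γ B (conclusion h)) p₁) ([]-weaken hs (swap Γ C (conclusion h)) q₁) ,
    []-∨-elim hs B C r p₂ q₂

  []-cut : ∀ hs → Γ ⊢ B → Γ ∪ ｛ B ｝ ⊢[ hs ] R → Γ ⊢[ hs ] R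
  []-cut {B = B} hs r p = []-∨-elim hs B B (∨-intro₁ B B r) p p

  private
    swap-∨ : ∀ A B C → Γ ∪ ｛ (A ∨̇ B) ∨̇ C ｝ ⊢ (A ∨̇ C) ∨̇ B
    swap-∨ A B C = ∨-case (A ∨̇ B) C
      (∨-case A B (∨-intro₁ (A ∨̇ C) B (∨-intro₁ A C (last A))) (∨-intro₂ (A ∨̇ C) B (last B)))
      (∨-intro₁ (A ∨̇ C) B (∨-intro₂ A C (last C)))

  -- A listed axiom can be used once more. At its own place in the list the doubled assumption is
  -- contracted and the doubled alternative merged; axioms before it are commuted past.
  []-axiom : ∀ {h} hs → h ∈ˡ hs →
             Γ ∪ ｛ conclusion h ｝ ⊢[ hs ] R → Γ ⊢[ hs ] R ∨̇ premise h → Γ ⊢[ hs ] R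
  []-axiom {Γ = Γ} {R = R} (h ∷ hs) (here refl) (p₁ , _) (_ , q₂) =
    []-weaken hs (contract Γ (conclusion h)) p₁ ,
    []-map hs (∨-case (R ∨̇ premise h) (premise h)
                (last (R ∨̇ premise h)) (∨-intro₂ R (premise h) (last (premise h)))) q₂
  []-axiom {Γ = Γ} {R = R} {h} (k ∷ hs) (there h∈) (p₁ , p₂) (q₁ , q₂) =
    []-axiom hs h∈ ([]-weaken hs (swap Γ (conclusion h) (conclusion k)) p₁) q₁ ,
    []-axiom hs h∈ p₂ ([]-map hs (swap-∨ R (premise h) (premise k)) q₂)

  -- Each use of an axiom of `hs` is replayed at its place in `ks`, so order and repetitions are
  -- immaterial.
  []-mono : ∀ hs ks → (_∈ˡ hs) ⊆ (_∈ˡ ks) → Γ ⊢[ hs ] R → Γ ⊢[ ks ] R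
  []-mono []       ks hs⊆ks p       = []-pure ks p
  []-mono (h ∷ hs) ks hs⊆ks (p , q) =
    []-axiom ks (hs⊆ks (here refl)) ([]-mono hs ks (hs⊆ks ∘ there) p) ([]-mono hs ks (hs⊆ks ∘ there) q)

  -- Elimination of the axioms.

  private
    self : ∀ h → ¬ (constant h occursIn Axiom.A h)
    self h = ≺⇒∉-matrix {h} {h} ≤-refl

    -- The constant of the axiom serves as eigenconstant. For `∃⁺` and `∀⁻` the premise is
    -- eliminated, discharging the conclusion; for `∀⁺` the instance is generalised with `R` as side
    -- formula of `∀I`.
    eliminate : ∀ h → Avoids (constant h) Γ → ¬ (constant h occursIn R) →
                Γ ∪ ｛ conclusion h ｝ ⊢ R → Γ ⊢ R ∨̇ premise h → Γ ⊢ R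
    eliminate {R = R} h@(axiom ∃⁺ A x∈A) c∉Γ c∉R p q =
      ∨-elim R (∃̇ A x∈A) q (last R)
        (∃-elim A x∈A (constant h) (self h) c∉R c∉Γ inj₁ (last (∃̇ A x∈A)) p)
    eliminate {R = R} h@(axiom ∀⁻ A x∈A) c∉Γ c∉R p q =
      ∨-elim R (¬̇ (∀̇ A x∈A)) q (last R)
        (¬∀-elim A x∈A (constant h) (self h) c∉R c∉Γ inj₁ (last (¬̇ (∀̇ A x∈A))) p)
    eliminate {R = R} h@(axiom ∀⁺ A x∈A) c∉Γ c∉R p q =
      ∨-elim R (∀̇ A x∈A) (∀-intro R A x∈A (constant h) (self h) c∉R c∉Γ q) (last R) p
    -- ¬∃I has no side formula R, but ∀I applied to ¬A does.
    eliminate {Γ = Γ} {R = R} h@(axiom ∃⁻ A x∈A) c∉Γ c∉R p q =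
      ∨-elim R (∀̇ (¬̇ A) x∈A) (∀-intro R (¬̇ A) x∈A (constant h) (self h) c∉R c∉Γ q) (last R)
        (cut (weaken {Δ = Γ ∪ ｛ ∀̇ (¬̇ A) x∈A ｝} inj₂ none) (inner (∀̇ (¬̇ A) x∈A) (¬̇ (∃̇ A x∈A)) p))
      where
      none : ｛ ∀̇ (¬̇ A) x∈A ｝ ⊢ ¬̇ (∃̇ A x∈A)
      none = ¬∃-intro A x∈A (constant h) (self h) (λ { refl → self h })
               (∀E (¬̇ A) x∈A (constant h) (hyp _) , λ { refl → refl })

    -- Later axioms go first: their constants avoid the conclusion of `h`, which joins the
    -- hypotheses, and its premise, which joins the goal. The constant of `h` then has to avoid only
    -- `Γ` and `R`.
    purge : ∀ hs → AllPairs _≺_ hs →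
            (∀ {h} → h ∈ˡ hs → Avoids (constant h) Γ) →
            (∀ {h} → h ∈ˡ hs → ¬ (constant h occursIn R)) →
            Γ ⊢[ hs ] R → Γ ⊢ R
    purge []       []             ∉Γ ∉R p       = p
    purge {R = R} (h ∷ hs) (h≺ ∷ ordered) ∉Γ ∉R (p , q) =
      eliminate h (∉Γ (here refl)) (∉R (here refl))
        (purge hs ordered
          (λ { k∈ (inj₁ H∈Γ) → ∉Γ (there k∈) H∈Γ
             ; {k} k∈ (inj₂ refl) → ≺⇒∉-conclusion h k (All.lookup h≺ k∈) })
          (∉R ∘ there) p)
        (purge hs ordered (∉Γ ∘ there)
          (λ {k} k∈ → [ ∉R (there k∈) , ≺⇒∉-premise h k (All.lookup h≺ k∈) ]′) q)

    insert : ∀ h hs → AllPairs _≺_ hs → ¬ h ∈ˡ hs →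
             ∃ λ ks → AllPairs _≺_ ks × (_∈ˡ ks) ⊆ (_∈ˡ (h ∷ hs)) × (_∈ˡ (h ∷ hs)) ⊆ (_∈ˡ ks)
    insert h []       []        h∉ = h ∷ [] , [] ∷ [] , id , id
    insert h (k ∷ hs) (k≺ ∷ ordered) h∉ with size (code h) ≤? size (code k)
    ... | yes h≤k = h ∷ k ∷ hs ,
      ((h≤k , λ { refl → h∉ (here refl) }) ∷
        All.tabulate (λ l∈ → ≤-trans h≤k (proj₁ (All.lookup k≺ l∈)) ,
                             λ { refl → h∉ (there l∈) })) ∷ k≺ ∷ ordered ,
      id , id
    ... | no h≰k with insert h hs ordered (h∉ ∘ there)
    ...   | ks , ordered′ , ks⊆ , ⊆ks = k ∷ ks ,
      All.tabulate (λ l∈ → first (ks⊆ l∈)) ∷ ordered′ ,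
      (λ { (here refl) → there (here refl) ; (there l∈) → move (ks⊆ l∈) }) ,
      (λ { (here refl) → there (⊆ks (here refl)) ; (there (here refl)) → here refl
         ; (there (there l∈)) → there (⊆ks (there l∈)) })
      where
      first : ∀ {l} → l ∈ˡ (h ∷ hs) → k ≺ l
      first (here refl) = <⇒≤ (≰⇒> h≰k) , λ { refl → h∉ (here refl) }
      first (there l∈)  = All.lookup k≺ l∈
      move : ∀ {l} → l ∈ˡ (h ∷ hs) → l ∈ˡ (h ∷ k ∷ hs)
      move (here refl) = here refl
      move (there l∈)  = there (there l∈)

  module _ (em : ExcludedMiddle ℓ) where

    private
      -- Insertion sort that drops duplicates, since `_≺_` is irreflexive.
      sort : ∀ hs → ∃ λ ks → AllPairs _≺_ ks × (_∈ˡ hs) ⊆ (_∈ˡ ks)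
      sort []       = [] , [] , id
      sort (h ∷ hs) with sort hs
      ... | ks , ordered , hs⊆ks with em {h ∈ˡ ks}
      ...   | yes h∈ks = ks , ordered , λ { (here refl) → h∈ks ; (there l∈) → hs⊆ks l∈ }
      ...   | no h∉ks with insert h ks ordered h∉ks
      ...     | ls , ordered′ , _ , ⊆ls = ls , ordered′ ,
        λ { (here refl) → ⊆ls (here refl) ; (there l∈) → ⊆ls (there (hs⊆ks l∈)) }

    []-conservative : ∀ hs → (∀ w → Avoids (inj₂ w) Γ) → (∀ w → ¬ (inj₂ w occursIn R)) →
                      Γ ⊢[ hs ] R → Γ ⊢ R
    []-conservative hs ∉Γ ∉R p with sort hs
    ... | ks , ordered , hs⊆ks =
      purge ks ordered (λ {h} _ → ∉Γ (code h)) (λ {h} _ → ∉R (code h))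
        ([]-mono hs ks hs⊆ks p)

    []-compact : ∀ hs → Γ ⊢[ hs ] R → ∃ λ Hs → (_∈ˡ Hs) ⊆ Γ × (_∈ˡ Hs ⊢[ hs ] R)
    []-compact {Γ = Γ} []       p       = compact em p
    []-compact {Γ = Γ} (h ∷ hs) (p , q) with []-compact hs p | []-compact hs q
    ... | Hs , Hs⊆ , p′ | Ks , Ks⊆ , q′ =
      -- The list for the first component may contain `conclusion h`. Unless it lies in `Γ` the
      -- filter drops it, and `left` finds it again as the adjoined hypothesis.
      filter inΓ (Hs ++ Ks) ,
      (λ H∈ → proj₂ (∈-filter⁻ inΓ {xs = Hs ++ Ks} H∈)) ,
      []-weaken hs left p′ ,
      []-weaken hs (λ H∈ → ∈-filter⁺ inΓ (∈-++⁺ʳ Hs H∈) (Ks⊆ H∈)) q′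
      where
      inΓ : ∀ H → Dec (Γ H)
      inΓ H = em
      left : (_∈ˡ Hs) ⊆ (_∈ˡ filter inΓ (Hs ++ Ks)) ∪ ｛ conclusion h ｝
      left H∈ with Hs⊆ H∈
      ... | inj₁ H∈Γ = inj₁ (∈-filter⁺ inΓ (∈-++⁺ˡ H∈) H∈Γ)
      ... | inj₂ eq  = inj₂ eq

-- Composition of renamings.

private
  module _ {𝒮 𝒯 𝒰 : Signature ℓ}
           (f : Const 𝒮 → Const 𝒯) (g : ∀ {n} → Letter 𝒮 n → Letter 𝒯 n)
           (f′ : Const 𝒯 → Const 𝒰) (g′ : ∀ {n} → Letter 𝒯 n → Letter 𝒰 n) where

    mapTerms-∘ : ∀ {n} (ts : Vec (Term 𝒮) n) →
      Vec.map (mapTerm {𝒮′ = 𝒰} f′) (Vec.map (mapTerm {𝒮′ = 𝒯} f) ts) ≡ Vec.map (mapTerm (f′ ∘ f)) ts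
    mapTerms-∘ []           = refl
    mapTerms-∘ (var x ∷ ts) = cong (var x ∷_) (mapTerms-∘ ts)
    mapTerms-∘ (con c ∷ ts) = cong (con (f′ (f c)) ∷_) (mapTerms-∘ ts)

    mapExpr-∘ : ∀ (A : Expr 𝒮) →
      mapExpr {𝒮′ = 𝒰} f′ g′ (mapExpr {𝒮′ = 𝒯} f g A) ≡ mapExpr (f′ ∘ f) (g′ ∘ g) A
    mapExpr-∘ (atom P ts) = cong (atom (g′ (g P))) (mapTerms-∘ ts)
    mapExpr-∘ (un # A)    = cong (un #) (mapExpr-∘ A)
    mapExpr-∘ (bin ⊗ A B) = cong₂ (bin ⊗) (mapExpr-∘ A) (mapExpr-∘ B)
    mapExpr-∘ (qu Q x A)  = cong (qu Q x) (mapExpr-∘ A)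

  mapTerms-id : ∀ {n} (ts : Vec (Term 𝒮) n) → Vec.map (mapTerm {𝒮′ = 𝒮} id) ts ≡ ts
  mapTerms-id []           = refl
  mapTerms-id (var x ∷ ts) = cong (var x ∷_) (mapTerms-id ts)
  mapTerms-id (con c ∷ ts) = cong (con c ∷_) (mapTerms-id ts)

  mapExpr-id : ∀ (A : Expr 𝒮) → mapExpr {𝒮′ = 𝒮} id id A ≡ A
  mapExpr-id (atom P ts) = cong (atom P) (mapTerms-id ts)
  mapExpr-id (un # A)    = cong (un #) (mapExpr-id A)
  mapExpr-id (bin ⊗ A B) = cong₂ (bin ⊗) (mapExpr-id A) (mapExpr-id B)
  mapExpr-id (qu Q x A)  = cong (qu Q x) (mapExpr-id A)

  new∉embed : ∀ {D : Set ℓ} (A : Expr 𝒮) {d : D} →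
              ¬ (inj₂ d ∈C mapExpr {𝒮′ = extend 𝒮 D} inj₁ id A)
  new∉embed {𝒮 = 𝒮} {D = D} (atom P ts) = terms ts
    where
    terms : ∀ {n d} (ts : Vec (Term 𝒮) n) → ¬ (con (inj₂ d) ∈ᵛ Vec.map (mapTerm {𝒮′ = extend 𝒮 D} inj₁) ts)
    terms (var _ ∷ ts) (Any.there p) = terms ts p
    terms (con _ ∷ ts) (Any.there p) = terms ts p
  new∉embed (un # A)             = new∉embed A
  new∉embed (bin ⊗ A B) (inj₁ p) = new∉embed A p
  new∉embed (bin ⊗ A B) (inj₂ p) = new∉embed B p
  new∉embed (qu Q x A)           = new∉embed A

-- Saturated theories

-- Theories are Boolean so that they can serve as valuations; the lift turns them into sets of
-- hypotheses.
True : {𝒮 : Signature ℓ} → (Sentence 𝒮 → Bool) → Pred (Sentence 𝒮) ℓ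
True {ℓ} M A = Lift ℓ (M A ≡ true)

record Saturated {𝒮 : Signature ℓ} (M : Sentence 𝒮 → Bool) : Set ℓ where
  field
    closed     : ∀ {A} → True M ⊢ A → M A ≡ true
    prime      : ∀ A B → M (A ∨̇ B) ≡ true → M A ≡ true ⊎ M B ≡ true
    consistent : ∃ λ A → M A ≢ true
    henkin-∃   : ∀ {x} (A : Form 𝒮 ｛ x ｝) .(x∈A : x ∈FV expr A) →
                 M (∃̇ A x∈A) ≡ true → ∃ λ c → M (A ⟨ c ⟩) ≡ true
    henkin-∀   : ∀ {x} (A : Form 𝒮 ｛ x ｝) .(x∈A : x ∈FV expr A) →
                 (∀ c → M (A ⟨ c ⟩) ≡ true) → M (∀̇ A x∈A) ≡ true
    henkin-¬∃  : ∀ {x} (A : Form 𝒮 ｛ x ｝) .(x∈A : x ∈FV expr A) →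
                 (∀ c → M (¬̇ (A ⟨ c ⟩)) ≡ true) → M (¬̇ (∃̇ A x∈A)) ≡ true
    henkin-¬∀  : ∀ {x} (A : Form 𝒮 ｛ x ｝) .(x∈A : x ∈FV expr A) →
                 M (¬̇ (∀̇ A x∈A)) ≡ true → ∃ λ c → M (¬̇ (A ⟨ c ⟩)) ≡ true

module _ (em : ExcludedMiddle ℓ) (ext : Extensionality ℓ ℓ) where

  module _ {𝒮 : Signature ℓ} where
    open Henkin 𝒮

    saturate : (Γ : Pred (Sentence 𝒮⁺) ℓ) (R : Sentence 𝒮⁺) →
               (∀ w → Avoids (inj₂ w) Γ) → (∀ w → ¬ (inj₂ w occursIn R)) → ¬ (Γ ⊢ R) →
               ∃ λ M → Saturated M × Γ ⊆ True M × M R ≢ true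
    saturate Γ R ∉Γ ∉R Γ⊬R = M , saturated , Γ⊆M , R∉M
      where
      -- The axioms are not sentences and cannot join the theory, so they are absorbed into badness.
      -- Conservativity keeps the empty list from being bad.
      Bad : List (Sentence 𝒮⁺) → Set ℓ
      Bad As = ∃ λ hs → Γ ∪ (_∈ˡ As) ⊢[ hs ] R

      open Tukey em ext Bad

      ¬Bad[] : ¬ Bad []
      ¬Bad[] (hs , p) =
        Γ⊬R ([]-conservative em hs ∉Γ ∉R ([]-weaken hs (λ { (inj₁ q) → q }) p))

      M : Subset
      M = proj₁ (maximal ¬Bad[])

      Δ : Pred (Sentence 𝒮⁺) ℓ
      Δ = Γ ∪ True M

      -- By compactness a list of hypotheses would suffice, and its members in `M` would form a bad
      -- list.
      Δ-consistent : ∀ hs → ¬ (Δ ⊢[ hs ] R)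
      Δ-consistent hs p with []-compact em hs p
      ... | As , As⊆Δ , q = proj₁ (proj₂ (maximal ¬Bad[])) {filter inM As}
        (hs , []-weaken hs left q) (λ A∈ → lower (proj₂ (∈-filter⁻ inM {xs = As} A∈)))
        where
        inM : ∀ A → Dec (True M A)
        inM A = em
        left : (_∈ˡ As) ⊆ Γ ∪ (_∈ˡ filter inM As)
        left A∈ with As⊆Δ A∈
        ... | inj₁ A∈Γ = inj₁ A∈Γ
        ... | inj₂ A∈M = inj₂ (∈-filter⁺ inM A∈ A∈M)

      -- By maximality a sentence outside `M` completes a bad list whose other members are in `M`.
      decide : ∀ A → M A ≡ true ⊎ ∃ λ hs → Δ ∪ ｛ A ｝ ⊢[ hs ] R
      decide A with M A in eq
      ... | true  = inj₁ refl
      ... | false with proj₂ (proj₂ (maximal ¬Bad[])) A (λ p → contra (trans (sym p) eq))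
        where
        contra : ¬ (true ≡ false)
        contra ()
      ...   | As , (hs , p) , As⊆ = inj₂ (hs , []-weaken hs inside p)
        where
        inside : Γ ∪ (_∈ˡ As) ⊆ Δ ∪ ｛ A ｝
        inside (inj₁ q) = inj₁ (inj₁ q)
        inside (inj₂ q) with As⊆ q
        ... | inj₁ r = inj₁ (inj₂ (lift r))
        ... | inj₂ r = inj₂ r

      closed : ∀ {A} → Δ ⊢ A → M A ≡ true
      closed {A} p with decide A
      ... | inj₁ q        = q
      ... | inj₂ (hs , q) = ⊥-elim (Δ-consistent hs ([]-cut hs p q))

      Γ⊆M : Γ ⊆ True M
      Γ⊆M A∈Γ = lift (closed (assume (inj₁ A∈Γ)))

      R∉M : M R ≢ true
      R∉M p = Δ-consistent [] (assume (inj₂ (lift p)))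

      prime : ∀ A B → M (A ∨̇ B) ≡ true → M A ≡ true ⊎ M B ≡ true
      prime A B p with decide A | decide B
      ... | inj₁ q | _      = inj₁ q
      ... | inj₂ _ | inj₁ r = inj₂ r
      ... | inj₂ (hs , q) | inj₂ (ks , r) = ⊥-elim (Δ-consistent (hs ++ ks)
        ([]-∨-elim (hs ++ ks) A B (assume (inj₂ (lift p)))
          ([]-mono hs (hs ++ ks) ∈-++⁺ˡ q) ([]-mono ks (hs ++ ks) (∈-++⁺ʳ hs) r)))

      -- If the conclusion leads to `R`, then the premise, being in `M`, supplies the other half of
      -- a derivation of `R` with `h` as an additional axiom.
      henkin : ∀ h → M (premise h) ≡ true → M (conclusion h) ≡ true
      henkin h p with decide (conclusion h)
      ... | inj₁ q        = q
      ... | inj₂ (hs , q) = ⊥-elim (Δ-consistent (h ∷ hs)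
        (q , []-pure hs (∨-intro₂ R (premise h) (assume (inj₂ (lift p))))))

      saturated : Saturated M
      saturated = record
        { closed     = λ p → closed (weaken inj₂ p)
        ; prime      = prime
        ; consistent = R , R∉M
        -- The omitted constants are those of the axioms. In the two dual clauses the instance at
        -- that constant suffices.
        ; henkin-∃   = λ A x∈A p → _ , henkin (axiom ∃⁺ A x∈A) p
        ; henkin-∀   = λ A x∈A p → henkin (axiom ∀⁺ A x∈A) (p _)
        ; henkin-¬∃  = λ A x∈A p → henkin (axiom ∃⁻ A x∈A) (p _)
        ; henkin-¬∀  = λ A x∈A p → _ , henkin (axiom ∀⁻ A x∈A) p
        }

  -- The canonical interpretation

  module Canonical {𝒮 : Signature ℓ} {W : Set ℓ} (M : Sentence (extend 𝒮 W) → Bool)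
                   (saturated : Saturated M) where
    open Saturated saturated

    private
      𝒮⁺ : Signature ℓ
      𝒮⁺ = extend 𝒮 W

      infix 4 _∈M
      _∈M : Sentence 𝒮⁺ → Set
      A ∈M = M A ≡ true

      by : ∀ {A H} → A ∈M → A ≡ H → True M H
      by p refl = lift p

      iff : ∀ {a b} → (a ≡ true → b ≡ true) → (b ≡ true → a ≡ true) → a ≡ b
      iff {true}  f g = sym (f refl)
      iff {false} {true}  f g = g refl
      iff {false} {false} f g = refl

      replace : ∀ (A : Form 𝒮⁺ ｛ x ｝) {c d} → c ≈̇ d ∈M → A ⟨ c ⟩ ∈M → A ⟨ d ⟩ ∈M
      replace A {c} {d} p q = closed (≈E A c d (hyp _) (hyp _) , [ by p , by q ]′)

      infix 4 _≋_
      _≋_ : Const 𝒮⁺ → Const 𝒮⁺ → Set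
      c ≋ d = c ≈̇ d ∈M

      ≋-refl : ∀ {c} → c ≋ c
      ≋-refl {c} = closed (≈I c , λ ())

      ≋-sym : ∀ {c d} → c ≋ d → d ≋ c
      ≋-sym {c} {d} p = replace
        -- The matrix is `x ≈ c`; replacement leads from `c ≈ c` to `d ≈ c`.
        (form {X = ｛ 0 ｝} (atom (identity 𝒮) (var 0 ∷ con c ∷ [])) tt
          λ { (Any.here refl) → refl ; (Any.there (Any.here ())) ; (Any.there (Any.there ())) })
        p ≋-refl

      ≋-trans : ∀ {c d e} → c ≋ d → d ≋ e → c ≋ e
      ≋-trans {c} {d} {e} p q = replace
        (form {X = ｛ 0 ｝} (atom (identity 𝒮) (con c ∷ var 0 ∷ [])) tt
          λ { (Any.there (Any.here refl)) → refl ; (Any.there (Any.there ())) })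
        q p

      -- By extensionality the representative depends on the class only.
      pick : (Const 𝒮⁺ → Bool) → Const 𝒮⁺
      pick C with em {∃ λ c → C c ≡ true}
      ... | yes (c , _) = c
      ... | no _        = proj₁ (fresh em {𝒮 = 𝒮⁺} [])

      pick-∈ : ∀ (C : Const 𝒮⁺ → Bool) → (∃ λ c → C c ≡ true) → C (pick C) ≡ true
      pick-∈ C inhabited with em {∃ λ c → C c ≡ true}
      ... | yes (_ , p) = p
      ... | no ¬p       = ⊥-elim (¬p inhabited)

      rep : Const 𝒮⁺ → Const 𝒮⁺
      rep c = pick (λ d → M (c ≈̇ d))

      ≋-rep : ∀ c → c ≋ rep c
      ≋-rep c = pick-∈ (λ d → M (c ≈̇ d)) (c , ≋-refl)

      ≋⇒rep≡ : ∀ {c d} → c ≋ d → rep c ≡ rep d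
      ≋⇒rep≡ p = cong pick (lower-extensionality ℓ ℓ ext λ e →
        iff (≋-trans (≋-sym p)) (≋-trans p))

      rep≡⇒≋ : ∀ {c d} → rep c ≡ rep d → c ≋ d
      rep≡⇒≋ {c} {d} eq = ≋-trans (≋-rep c) (subst (_≋ d) (sym eq) (≋-sym (≋-rep d)))

      -- The quotient by `_≋_`, realised as the set of representatives. The proofs are unique, so
      -- equal constants give equal elements.
      Element : Set ℓ
      Element = ∃ λ c → rep c ≡ c

      element : Const 𝒮⁺ → Element
      element c = rep c , sym (≋⇒rep≡ (≋-rep c))

      element-≡ : ∀ {a b : Element} → proj₁ a ≡ proj₁ b → a ≡ b
      element-≡ {c , p} {.c , q} refl = cong (c ,_) (≡-irrelevant p q)

    -- Positive and negative extensions are read off `M` separately, since they need be neither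
    -- disjoint nor exhaustive.
    𝔄 : Structure 𝒮
    𝔄 = record
      { Domain    = Element
      ; inhabited = element (proj₁ (fresh em {𝒮 = 𝒮⁺} []))
      ; ⟦_⟧ᶜ      = λ c → element (inj₁ c)
      ; ⟦_⟧₊      = λ P as → True M (atomic P (Vec.map proj₁ as))
      ; ⟦_⟧₋      = λ P as → True M (¬̇ atomic P (Vec.map proj₁ as))
      ; identity₊ = λ (c , p) (d , q) → mk⇔
          (λ (lift r) → element-≡ (trans (sym p) (trans (≋⇒rep≡ r) q)))
          (λ { refl → lift ≋-refl })
      }

    private
      open Structure (expansion 𝔄) using () renaming (⟦_⟧ᶜ to ⟦_⟧)

      -- An element is itself a constant and so can replace its name. Diagram sentences thereby
      -- become sentences that `M` evaluates.
      interpret : Const (diagram 𝔄) → Const 𝒮⁺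
      interpret (inj₁ c)       = inj₁ c
      interpret (inj₂ (c , _)) = c

      ⟦⟧-interpret : ∀ c → proj₁ ⟦ c ⟧ ≡ rep (interpret c)
      ⟦⟧-interpret (inj₁ c)       = refl
      ⟦⟧-interpret (inj₂ (c , p)) = sym p

      interpret-≋ : ∀ c → interpret c ≋ proj₁ ⟦ c ⟧
      interpret-≋ c = subst (interpret c ≋_) (sym (⟦⟧-interpret c)) (≋-rep (interpret c))

      open Renaming {𝒮 = diagram 𝔄} {𝒯 = 𝒮⁺} id

      cons : ∀ {n} → Vec (Const 𝒮⁺) n → Vec (Term 𝒮⁺) n
      cons = Vec.map con

      noVars : ∀ {n y} (cs : Vec (Const 𝒮⁺) n) → ¬ (var {𝒮 = 𝒮⁺} y ∈ᵛ cons cs)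
      noVars (c ∷ cs) (Any.there p) = noVars cs p

      subst-cons : ∀ {n} (cs : Vec (Const 𝒮⁺) n) c →
        Vec.map (λ t → substTerm t c x) (cons cs) ≡ cons cs
      subst-cons []       c = refl
      subst-cons (d ∷ cs) c = cong (con {𝒮 = 𝒮⁺} d ∷_) (subst-cons cs c)

      -- Arguments are replaced from left to right; F prefixes those already
      -- replaced.
      module _ (Φ : ∀ {V} → Form 𝒮⁺ V → Form 𝒮⁺ V)
               (Φ-⟨⟩ : ∀ {x} (A : Form 𝒮⁺ ｛ x ｝) c → Φ A ⟨ c ⟩ ≡ Φ (A ⟨ c ⟩))
               {n} (P : Letter 𝒮 n) where

        prefixed-cong : ∀ {k} (F : Vec (Term 𝒮⁺) k → Vec (Term 𝒮⁺) n)
          (F-subst : ∀ ts c x → Vec.map (λ t → substTerm t c x) (F ts) ≡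
                                F (Vec.map (λ t → substTerm t c x) ts))
          (F-vars : ∀ {ts y} → var y ∈ᵛ F ts → var y ∈ᵛ ts) →
          ∀ {cs ds} → Pointwise _≋_ cs ds →
          Φ (form (atom P (F (cons cs))) tt (noVars cs ∘ F-vars)) ∈M →
          Φ (form (atom P (F (cons ds))) tt (noVars ds ∘ F-vars)) ∈M
        prefixed-cong F F-subst F-vars []                        p = p
        prefixed-cong F F-subst F-vars {c ∷ cs} {d ∷ ds} (c≋d ∷ cs≋ds) p =
          prefixed-cong (F ∘ (con {𝒮 = 𝒮⁺} d ∷_)) (λ ts → F-subst (con d ∷ ts)) (λ q → tail (F-vars q))
            cs≋ds (subst _∈M (at d) (replace (Φ A) c≋d (subst _∈M (sym (at c)) p)))
          where
          tail : ∀ {m y e} {ts : Vec (Term 𝒮⁺) m} → var y ∈ᵛ con e ∷ ts → var y ∈ᵛ ts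
          tail (Any.there q) = q

          first : ∀ {y} → var y ∈ᵛ var 0 ∷ cons cs → 0 ≡ y
          first (Any.here refl) = refl
          first (Any.there q)   = ⊥-elim (noVars cs q)

          -- The argument to be replaced is abstracted to variable 0, the only variable since all
          -- other arguments are constants.
          A : Form 𝒮⁺ ｛ 0 ｝
          A = form (atom P (F (var 0 ∷ cons cs))) tt (first ∘ F-vars)

          at : ∀ e → Φ A ⟨ e ⟩ ≡
               Φ (form (atom P (F (con e ∷ cons cs))) tt (noVars (e ∷ cs) ∘ F-vars))
          at e = trans (Φ-⟨⟩ A e) (cong Φ (form-≡ {𝒮 = 𝒮⁺} (cong (atom P)
            (trans (F-subst _ e 0) (cong (λ ts → F (con e ∷ ts)) (subst-cons cs e))))))

        atomic-cong : ∀ {cs ds} → Pointwise _≋_ cs ds → Φ (atomic P cs) ∈M → Φ (atomic P ds) ∈M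
        atomic-cong = prefixed-cong id (λ _ _ _ → refl) id

        -- Taking the identity and negation for `Φ` gives the clauses for atoms and for negated
        -- atoms. Constants are exchanged for their representatives under `_≋_`.
        interpret-atomic : ∀ cs → Φ (rename interpret (atomic P cs)) ∈M ⇔
                                  True M (Φ (atomic P (Vec.map proj₁ (Vec.map ⟦_⟧ cs))))
        interpret-atomic cs = mk⇔
          (λ p → lift (atomic-cong (to cs) (subst (λ (B : Sentence 𝒮⁺) → Φ B ∈M) named p)))
          (λ (lift p) → subst (λ (B : Sentence 𝒮⁺) → Φ B ∈M) (sym named) (atomic-cong (from cs) p))
          where
          names : ∀ {k} (cs : Vec (Const (diagram 𝔄)) k) →
            Vec.map (mapTerm {𝒮′ = 𝒮⁺} interpret) (Vec.map con cs) ≡ cons (Vec.map interpret cs)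
          names []       = refl
          names (c ∷ cs) = cong (con (interpret c) ∷_) (names cs)

          named : rename interpret (atomic P cs) ≡ atomic P (Vec.map interpret cs)
          named = form-≡ (cong (atom P) (names cs))

          to : ∀ {k} (cs : Vec _ k) →
            Pointwise _≋_ (Vec.map interpret cs) (Vec.map proj₁ (Vec.map ⟦_⟧ cs))
          to []       = []
          to (c ∷ cs) = interpret-≋ c ∷ to cs

          from : ∀ {k} (cs : Vec _ k) →
            Pointwise _≋_ (Vec.map proj₁ (Vec.map ⟦_⟧ cs)) (Vec.map interpret cs)
          from []       = []
          from (c ∷ cs) = ≋-sym (interpret-≋ c) ∷ from cs

    valuation : Sentence (diagram 𝔄) → Bool
    valuation A = M (rename interpret A)

    private
      Holds : Sentence (diagram 𝔄) → Set
      Holds A = valuation A ≡ true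

      ∨-split : ∀ A B → A ∨̇ B ∈M ⇔ (A ∈M ⊎ B ∈M)
      ∨-split A B = mk⇔ (prime A B)
        [ (λ p → closed (∨I₁ A B (hyp _) , by p)) , (λ p → closed (∨I₂ A B (hyp _) , by p)) ]′

      ¬∧-split : ∀ A B → ¬̇ (A ∧̇ B) ∈M ⇔ (¬̇ A ∈M ⊎ ¬̇ B ∈M)
      ¬∧-split A B = mk⇔
        (λ p → prime (¬̇ A) (¬̇ B) (closed (¬∧-elim A B (assume (lift p))
          (∨-intro₁ (¬̇ A) (¬̇ B) (assume (inj₂ refl))) (∨-intro₂ (¬̇ A) (¬̇ B) (assume (inj₂ refl))))))
        [ (λ p → closed (¬∧I₁ A B (hyp _) , by p)) , (λ p → closed (¬∧I₂ A B (hyp _) , by p)) ]′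

      explode : ∀ A → ∘̇ A ∈M → A ∈M → M (¬̇ A) ≢ true
      explode A p q r with consistent
      ... | B , B∉M = B∉M (closed (EXP° {A = A} B (hyp _) (hyp _) (hyp _) , [ by p , [ by q , by r ]′ ]′))

      decided : ∀ A → ∘̇ A ∈M → M (¬̇ A) ≡ false → A ∈M
      decided A p q with prime A (¬̇ A) (closed (PEM° A (hyp _) , by p))
      ... | inj₁ r = r
      ... | inj₂ r with trans (sym r) q
      ...   | ()

      circ-bullet : ∀ A → ∘̇ A ∈M ⇔ M (●̇ A) ≡ false
      circ-bullet A = mk⇔ (λ p → ¬-not (incompatible p)) exhaustive
        where
        incompatible : ∘̇ A ∈M → M (●̇ A) ≢ true
        incompatible p q with consistent
        ... | B , B∉M = B∉M (closed (Cons A B (hyp _) (hyp _) , [ by p , by q ]′))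
        exhaustive : M (●̇ A) ≡ false → ∘̇ A ∈M
        exhaustive p with prime (∘̇ A) (●̇ A) (closed (Comp A , λ ()))
        ... | inj₁ r = r
        ... | inj₂ r with trans (sym r) p
        ...   | ()

      ∧-split : ∀ A B → A ∧̇ B ∈M ⇔ (A ∈M × B ∈M)
      ∧-split A B = mk⇔
        (λ p → closed (∧E₁ A B (hyp _) , by p) , closed (∧E₂ A B (hyp _) , by p))
        (λ (p , q) → closed (∧I {A = A} {B = B} (hyp _) (hyp _) , [ by p , by q ]′))

      ¬∨-split : ∀ A B → ¬̇ (A ∨̇ B) ∈M ⇔ (¬̇ A ∈M × ¬̇ B ∈M)
      ¬∨-split A B = mk⇔
        (λ p → closed (¬∨E₁ A B (hyp _) , by p) , closed (¬∨E₂ A B (hyp _) , by p))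
        (λ (p , q) → closed (¬∨I A B (hyp _) (hyp _) , [ by p , by q ]′))

      -- Semantic quantifiers range over representatives, the Henkin properties over all constants;
      -- replacement of identicals links the two.
      everywhere : ∀ (C : Form 𝒮⁺ ｛ x ｝) → (∀ (a : Element) → C ⟨ proj₁ a ⟩ ∈M) → ∀ c → C ⟨ c ⟩ ∈M
      everywhere C p c = replace C (≋-sym (≋-rep c)) (p (element c))

      somewhere : ∀ (C : Form 𝒮⁺ ｛ x ｝) → (∃ λ c → C ⟨ c ⟩ ∈M) → ∃ λ (a : Element) → C ⟨ proj₁ a ⟩ ∈M
      somewhere C (c , p) = element c , replace C (≋-rep c) p

      module _ (A : Form (diagram 𝔄) ｛ x ｝) where

        Â : Form 𝒮⁺ ｛ x ｝
        Â = rename interpret A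

        ∈Â : x ∈FV expr A → x ∈FV expr Â
        ∈Â = FV-map⁺ {𝒮′ = 𝒮⁺} interpret id (expr A)

        ⟨⟩⁺ : ∀ a → Â ⟨ interpret a ⟩ ∈M → Holds (A ⟨ a ⟩)
        ⟨⟩⁺ a = subst _∈M (sym (rename-⟨⟩ interpret A a))

        ⟨⟩⁻ : ∀ a → Holds (A ⟨ a ⟩) → Â ⟨ interpret a ⟩ ∈M
        ⟨⟩⁻ a = subst _∈M (rename-⟨⟩ interpret A a)

    isValuation : IsValuation 𝔄 valuation
    isValuation = record
      { v-atom  = interpret-atomic id (λ _ _ → refl)
      ; v-¬atom = interpret-atomic ¬̇_ (λ _ _ → refl)
      ; v-∧     = λ A B → ∧-split (rename interpret A) (rename interpret B)
      ; v-∨     = λ A B → ∨-split (rename interpret A) (rename interpret B)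
      ; v-¬∧    = λ A B → ¬∧-split (rename interpret A) (rename interpret B)
      ; v-¬∨    = λ A B → ¬∨-split (rename interpret A) (rename interpret B)
      ; v-¬¬    = λ A → mk⇔
          (λ p → closed (DNE {A = rename interpret A} (hyp _) , by p))
          (λ p → closed (DNI {A = rename interpret A} (hyp _) , by p))
      ; v-∘     = λ A p → mk⇔
          (λ q → ¬-not (explode (rename interpret A) p q)) (decided (rename interpret A) p)
      ; v-●     = λ A → circ-bullet (rename interpret A)
      ; v-∀     = λ A x∈A → mk⇔
          (λ p a → ⟨⟩⁺ A (inj₂ a) (closed (∀E (Â A) (∈Â A x∈A) (proj₁ a) (hyp _) , by p)))
          (λ p → henkin-∀ (Â A) (∈Â A x∈A) (everywhere (Â A) (λ a → ⟨⟩⁻ A (inj₂ a) (p a))))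
      ; v-∃     = λ A x∈A → mk⇔
          (λ p → let a , q = somewhere (Â A) (henkin-∃ (Â A) (∈Â A x∈A) p) in a , ⟨⟩⁺ A (inj₂ a) q)
          (λ (a , p) → closed (∃I (Â A) (∈Â A x∈A) (proj₁ a) (hyp _) , by (⟨⟩⁻ A (inj₂ a) p)))
      ; v-¬∀    = λ A x∈A → mk⇔
          (λ p → let a , q = somewhere (¬̇ Â A) (henkin-¬∀ (Â A) (∈Â A x∈A) p)
                 in a , ⟨⟩⁺ (¬̇ A) (inj₂ a) q)
          (λ (a , p) → closed (¬∀I (Â A) (∈Â A x∈A) (proj₁ a) (hyp _) , by (⟨⟩⁻ (¬̇ A) (inj₂ a) p)))
      ; v-¬∃    = λ A x∈A → mk⇔
          (λ p a → ⟨⟩⁺ (¬̇ A) (inj₂ a) (closed (¬∃E (Â A) (∈Â A x∈A) (proj₁ a) (hyp _) , by p)))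
          (λ p → henkin-¬∃ (Â A) (∈Â A x∈A) (everywhere (¬̇ Â A) (λ a → ⟨⟩⁻ (¬̇ A) (inj₂ a) (p a))))
      ; v-AV    = λ A A′ A∼A′ → let m = ExprMatch-map interpret A∼A′ in iff
          (λ p → closed (AV {A = rename interpret A′} {A′ = rename interpret A} (ExprMatch-sym m) (hyp _) , by p))
          (λ p → closed (AV {A = rename interpret A} {A′ = rename interpret A′} m (hyp _) , by p))
      -- Equal denotations put the identity of the two constants into `M`, and replacement is then
      -- applied to the matrix with `#` in front.
      ; v-≈     = λ A c d c≡d _ # →
          let c≋d = rep≡⇒≋ (trans (sym (⟦⟧-interpret c)) (trans (cong proj₁ c≡d) (⟦⟧-interpret d)))
          in iff
            (λ p → ⟨⟩⁺ (unary # A) d (replace (unary # (Â A)) c≋d (⟨⟩⁻ (unary # A) c p)))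
            (λ p → ⟨⟩⁺ (unary # A) c (replace (unary # (Â A)) (≋-sym c≋d) (⟨⟩⁻ (unary # A) d p)))
      }

    interpretation : Interpretation 𝒮
    interpretation = record { structure = 𝔄 ; valuation = valuation ; isValuation = isValuation }

    -- Embedding into the diagram signature and then interpreting fixes the original constants,
    -- which amounts to embedding into `𝒮⁺`.
    valuation-embed : ∀ (A : Sentence 𝒮) → valuation (embed A) ≡ M (embed A)
    valuation-embed A = cong M (form-≡ (mapExpr-∘ {𝒯 = diagram 𝔄} {𝒰 = 𝒮⁺} inj₁ id interpret id (expr A)))

-- Completeness, by passing to the extended signature and back.

theorem19 : ∀ {ℓ} → ExcludedMiddle ℓ → Extensionality ℓ ℓ →
    (𝒮 : Signature ℓ) (Γ : Pred (Sentence 𝒮) ℓ) (A : Sentence 𝒮) →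
    Γ ⊨ A → Γ ⊢ A
theorem19 em ext 𝒮 Γ A Γ⊨A with em {Γ ⊢ A}
... | yes Γ⊢A = Γ⊢A
... | no Γ⊬A with saturate em ext Γ⁺ (embed A) new∉Γ⁺ (λ _ → new∉embed (expr A)) Γ⁺⊬A
  where
  open Henkin 𝒮 using (𝒮⁺)

  Γ⁺ : Pred (Sentence 𝒮⁺) _
  Γ⁺ B = ∃ λ H → Γ H × embed H ≡ B

  new∉Γ⁺ : ∀ w → Avoids (inj₂ w) Γ⁺
  new∉Γ⁺ w (H , _ , refl) = new∉embed (expr H)

  -- A retraction that sends every added constant to one arbitrary original constant. Renaming along
  -- it turns a derivation from `Γ⁺` into one from `Γ`.
  collapse : Const 𝒮⁺ → Const 𝒮
  collapse = [ id , const (proj₁ (fresh em {𝒮 = 𝒮} [])) ]′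

  open Renaming {𝒮 = 𝒮⁺} {𝒯 = 𝒮} id

  collapse-embed : ∀ B → rename collapse (embed B) ≡ B
  collapse-embed B = form-≡
    (trans (mapExpr-∘ {𝒰 = 𝒮} inj₁ id collapse id (expr B)) (mapExpr-id (expr B)))

  Γ⁺⊬A : ¬ (Γ⁺ ⊢ embed A)
  Γ⁺⊬A (d , s) = Γ⊬A (subst (Γ ⊢_) (collapse-embed A)
    (⊢-rename em id refl collapse d λ h → preimage (s h)))
    where
    preimage : ∀ {B} → Γ⁺ B → Γ (rename collapse B)
    preimage (H , H∈Γ , refl) = subst Γ (sym (collapse-embed H)) H∈Γ
... | M , saturated , Γ⁺⊆M , A∉M = ⊥-elim (A∉M (trans (sym (valuation-embed A))
  (Γ⊨A interpretation λ {H} H∈Γ → trans (valuation-embed H) (lower (Γ⁺⊆M (H , H∈Γ , refl))))))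
  where open Canonical em ext {𝒮 = 𝒮} M saturated
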